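{- Let $q=1-p=o\!\left(\frac{1}{n^{1.5}}\right)$. Then for all sufficiently large $n\in\mathbb{N}$ we have $u_2(n,p)=u_2'(n,p)=3$.
   Context: $G(n,p)$ is the Erdős–Rényi random graph on $n$ labelled vertices (vertex set $V$), each edge present independently with probability $p=p(n)$; $\mathbb{P}_{n,p}$ is the corresponding probability and $q=1-p$. A diameter graph in $\mathbb{R}^d$ is a graph $(V,E)$ with $V\subset\mathbb{R}^d$ finite and $E=\{\{\mathbf{x},\mathbf{y}\}\subseteq V: |\mathbf{x}-\mathbf{y}|=\operatorname{diam}V\}$, where $\operatorname{diam}V=\max_{\mathbf{x},\mathbf{y}\in V}|\mathbf{x}-\mathbf{y}|$ (Euclidean norm); a graph is a diameter graph in $\mathbb{R}^d$ if it is isomorphic to one. $u_d(n,p)$ is the largest positive integer $k$ such that $\mathbb{P}_{n,p}\big(\exists W\subseteq V,\ |W|=k,\ G[W]$ is a diameter graph in $\mathbb{R}^d$ and $\chi(G[W])=d+1\big)>\frac12$, where $G[W]$ is the induced subgraph; if no such $k$ exists, $u_d(n,p)=0$. $u_d'(n,p)$ is defined identically with the additional requirement that $G[W]$ be connected. -}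

module Defs where

open import Data.Bool using (Bool; true; false; if_then_else_; T)
open import Data.Empty using (⊥; ⊥-elim)
open import Data.Fin using (Fin; zero; suc)
open import Data.Fin.Subset using (Subset; _∈_; inside; outside) renaming (∣_∣ to card)
open import Data.Integer as ℤ using (+_)
import Data.Integer.Properties as ℤ
open import Data.List as List using (List; []; _∷_)
open import Data.Nat as ℕ using (ℕ; zero; suc)
import Data.Nat.Properties as ℕ
open import Data.Product using (Σ; ∃; _×_; _,_)
open import Data.Rational as ℚ using (ℚ; 0ℚ; 1ℚ; ½; ↥_)
import Data.Rational.Properties as ℚ
import Data.Rational.Unnormalised as ℚᵘ
import Data.Rational.Unnormalised.Properties as ℚᵘ
open import Data.Rational.Solver using (module +-*-Solver)
open import Data.Sum using (_⊎_; inj₁; inj₂)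
open import Data.Vec as Vec using ([]; _∷_)
import Data.Vec.Functional as Vector
open import Function using (_∘_)
open import Function.Bundles using (_↔_; _⇔_; Inverse)
open import Relation.Binary.Construct.Closure.ReflexiveTransitive using (Star)
open import Relation.Binary.PropositionalEquality
  using (_≡_; _≢_; refl; sym; trans; cong; cong₂; subst; subst₂)
open import Relation.Nullary using (¬_; Dec; does; yes; no)

module Estimates where
  open import Data.Rational using (_+_; _*_; _-_; -_; _<_; _≤_; ∣_∣; _/_; 1/_)
  open ℚ.≤-Reasoning

  pos-+ : ∀ {p q} → 0ℚ < p → 0ℚ < q → 0ℚ < p + q
  pos-+ 0<p 0<q = ℚ.+-mono-< 0<p 0<q

  pos-* : ∀ {p q} → 0ℚ < p → 0ℚ < q → 0ℚ < p * q
  pos-* {p} {q} 0<p 0<q =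
    ℚ.positive⁻¹ (p * q) {{ℚ.pos*pos⇒pos p {{ℚ.positive 0<p}} q {{ℚ.positive 0<q}}}}

  half : ℚ → ℚ
  half ε = ½ * ε

  half-pos : ∀ {ε} → 0ℚ < ε → 0ℚ < half ε
  half-pos = pos-* (ℚ.positive⁻¹ ½)

  half+half : ∀ ε → half ε + half ε ≡ ε
  half+half ε = trans (sym (ℚ.*-distribʳ-+ ε ½ ½)) (ℚ.*-identityˡ ε)

  <-half : ∀ {p q} ε → p < half ε → q < half ε → p + q < ε
  <-half ε p< q< = subst (_ <_) (half+half ε) (ℚ.+-mono-< p< q<)

  <+⇒-< : ∀ {p q ε} → p < q + ε → p - q < ε
  <+⇒-< {p} {q} {ε} p<q+ε = subst (p - q <_) eq (ℚ.+-monoˡ-< (- q) p<q+ε)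
    where
    open +-*-Solver
    eq : q + ε - q ≡ ε
    eq = solve 2 (λ q ε → q :+ ε :- q := ε) refl q ε

  -<⇒<+ : ∀ {p q ε} → p - q < ε → p < q + ε
  -<⇒<+ {p} {q} {ε} p-q<ε = subst (_< q + ε) eq (ℚ.+-monoʳ-< q p-q<ε)
    where
    open +-*-Solver
    eq : q + (p - q) ≡ p
    eq = solve 2 (λ p q → q :+ (p :- q) := p) refl p q

  flip-- : ∀ p q → - (p - q) ≡ q - p
  flip-- = solve 2 (λ p q → :- (p :- q) := q :- p) refl
    where open +-*-Solver

  ∣-∣-swap : ∀ p q → ∣ p - q ∣ ≡ ∣ q - p ∣
  ∣-∣-swap p q = trans (sym (ℚ.∣-p∣≡∣p∣ (p - q))) (cong ∣_∣ (flip-- p q))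

  p≤∣p∣ : ∀ p → p ≤ ∣ p ∣
  p≤∣p∣ p with ℚ.≤-total 0ℚ p
  ... | inj₁ 0≤p = ℚ.≤-reflexive (sym (ℚ.0≤p⇒∣p∣≡p 0≤p))
  ... | inj₂ p≤0 = ℚ.≤-trans p≤0 (ℚ.0≤∣p∣ p)

  ∣-∣-two-sided : ∀ {p q ε} → p < q + ε → q < p + ε → ∣ p - q ∣ < ε
  ∣-∣-two-sided {p} {q} {ε} p< q< with ℚ.∣p∣≡p∨∣p∣≡-p (p - q)
  ... | inj₁ eq = subst (_< ε) (sym eq) (<+⇒-< p<)
  ... | inj₂ eq = subst (_< ε) (sym (trans eq (flip-- p q))) (<+⇒-< q<)

  ∣-∣-one-sided : ∀ {p q ε} → ∣ p - q ∣ < ε → p < q + ε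
  ∣-∣-one-sided {p} {q} h = -<⇒<+ (ℚ.≤-<-trans (p≤∣p∣ (p - q)) h)

  ∣p∣<∣q∣+ε : ∀ {p q ε} → ∣ p - q ∣ < ε → ∣ p ∣ < ∣ q ∣ + ε
  ∣p∣<∣q∣+ε {p} {q} {ε} h = begin-strict
    ∣ p ∣             ≡⟨ cong ∣_∣ (solve 2 (λ p q → p := q :+ (p :- q)) refl p q) ⟩
    ∣ q + (p - q) ∣   ≤⟨ ℚ.∣p+q∣≤∣p∣+∣q∣ q (p - q) ⟩
    ∣ q ∣ + ∣ p - q ∣ <⟨ ℚ.+-monoʳ-< ∣ q ∣ h ⟩
    ∣ q ∣ + ε         ∎
    where open +-*-Solver

  *-mono-≤-nonNeg : ∀ {p q r s} → 0ℚ ≤ p → 0ℚ ≤ s → p ≤ q → r ≤ s → p * r ≤ q * s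
  *-mono-≤-nonNeg {p} {q} {r} {s} 0≤p 0≤s p≤q r≤s = ℚ.≤-trans
    (ℚ.*-monoˡ-≤-nonNeg p {{ℚ.nonNegative 0≤p}} r≤s)
    (ℚ.*-monoʳ-≤-nonNeg s {{ℚ.nonNegative 0≤s}} p≤q)

  divide : ∀ {K ε} → 0ℚ < K → 0ℚ < ε → ∃ λ δ → 0ℚ < δ × K * δ ≡ ε
  divide {K} {ε} 0<K 0<ε = 1/ K * ε , pos-* (ℚ.positive⁻¹ (1/ K) {{ℚ.1/pos⇒pos K}}) 0<ε
    , trans (sym (ℚ.*-assoc K (1/ K) ε)) (trans (cong (_* ε) (ℚ.*-inverseʳ K)) (ℚ.*-identityˡ ε))
    where
    instance
      K⁺ = ℚ.positive 0<K
      K≢0 = ℚ.pos⇒nonZero K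

  ι : ℕ → ℚ
  ι n = + n / 1

  step : ℕ → ℚ
  step n = + 1 / suc n

  step-pos : ∀ n → 0ℚ < step n
  step-pos n = ℚ.positive⁻¹ (step n) {{ℚ.normalize-pos 1 (suc n)}}

  ι-suc : ∀ n → ι (suc n) ≡ ι n + 1ℚ
  ι-suc n = ℚ.toℚᵘ-injective (ℚᵘ.≃-trans (ℚ.toℚᵘ-fromℚᵘ (ℚᵘ.mkℚᵘ (+ suc n) 0))
    (ℚᵘ.≃-trans (ℚᵘ.*≡* eq) (ℚᵘ.≃-sym (ℚᵘ.≃-trans (ℚ.toℚᵘ-homo-+ (ι n) 1ℚ)
      (ℚᵘ.+-cong (ℚ.toℚᵘ-fromℚᵘ (ℚᵘ.mkℚᵘ (+ n) 0)) ℚᵘ.≃-refl)))))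
    where
    eq : + suc n ℤ.* (+ 1 ℤ.* + 1) ≡ (+ n ℤ.* + 1 ℤ.+ + 1 ℤ.* + 1) ℤ.* + 1
    eq = trans (ℤ.*-identityʳ (+ suc n)) (sym (trans (ℤ.*-identityʳ (+ n ℤ.* + 1 ℤ.+ + 1))
           (trans (cong (ℤ._+ + 1) (ℤ.*-identityʳ (+ n))) (cong +_ (ℕ.+-comm n 1)))))

  ι-+ : ∀ m n → ι (m ℕ.+ n) ≡ ι m + ι n
  ι-+ zero n = sym (ℚ.+-identityˡ (ι n))
  ι-+ (suc m) n = trans (ι-suc (m ℕ.+ n)) (trans (cong (_+ 1ℚ) (ι-+ m n))
    (trans (solve 3 (λ a b c → a :+ b :+ c := a :+ c :+ b) refl (ι m) (ι n) 1ℚ)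
      (cong (_+ ι n) (sym (ι-suc m)))))
    where open +-*-Solver

  ι-* : ∀ m n → ι (m ℕ.* n) ≡ ι m * ι n
  ι-* zero n = sym (ℚ.*-zeroˡ (ι n))
  ι-* (suc m) n = trans (ι-+ n (m ℕ.* n)) (trans (cong (λ t → ι n + t) (ι-* m n))
    (trans (solve 2 (λ a b → b :+ a :* b := (a :+ con 1ℚ) :* b) refl (ι m) (ι n))
      (cong (_* ι n) (sym (ι-suc m)))))
    where open +-*-Solver

  0≤ι : ∀ n → 0ℚ ≤ ι n
  0≤ι n = ℚ.nonNegative⁻¹ (ι n) {{ℚ.normalize-nonNeg n 1}}

  ι-mono : ∀ {m n} → m ℕ.≤ n → ι m ≤ ι n
  ι-mono {m} {n} m≤n = subst₂ _≤_ (ℚ.+-identityʳ (ι m))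
    (trans (sym (ι-+ m (n ℕ.∸ m))) (cong ι (ℕ.m+[n∸m]≡n m≤n)))
    (ℚ.+-monoʳ-≤ (ι m) (0≤ι (n ℕ.∸ m)))

  ι-step : ∀ n → ι (suc n) * step n ≡ 1ℚ
  ι-step n = ℚ.toℚᵘ-injective (ℚᵘ.≃-trans (ℚ.toℚᵘ-homo-* (ι (suc n)) (step n))
    (ℚᵘ.≃-trans (ℚᵘ.*-cong (ℚ.toℚᵘ-fromℚᵘ (ℚᵘ.mkℚᵘ (+ suc n) 0))
                            (ℚ.toℚᵘ-fromℚᵘ (ℚᵘ.mkℚᵘ (+ 1) n)))
      (ℚᵘ.*≡* eq)))
    where
    eq : (+ suc n ℤ.* + 1) ℤ.* + 1 ≡ + 1 ℤ.* (+ 1 ℤ.* + suc n)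
    eq = trans (ℤ.*-identityʳ (+ suc n ℤ.* + 1)) (trans (ℤ.*-identityʳ (+ suc n))
           (sym (trans (ℤ.*-identityˡ (+ 1 ℤ.* + suc n)) (ℤ.*-identityˡ (+ suc n)))))

  -- Archimedes: every rational is bounded by its numerator.
  r<ι : ∀ r → r < ι (suc ℤ.∣ ↥ r ∣)
  r<ι r@(ℚ.mkℚ n d-1 c) = ℚ.≤-<-trans r≤ (subst (ι k <_) (sym (ι-suc k)) k<k+1)
    where
    k = ℤ.∣ n ∣
    i≤∣i∣ : ∀ i → i ℤ.≤ + ℤ.∣ i ∣
    i≤∣i∣ (ℤ.+ _)    = ℤ.≤-refl
    i≤∣i∣ ℤ.-[1+ _ ] = ℤ.-≤+
    r≤ : r ≤ ι k
    r≤ = ℚ.toℚᵘ-cancel-≤ (ℚᵘ.≤-respʳ-≃ (ℚᵘ.≃-sym (ℚ.toℚᵘ-fromℚᵘ (ℚᵘ.mkℚᵘ (+ k) 0)))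
      (ℚᵘ.*≤* (ℤ.≤-trans (ℤ.≤-reflexive (ℤ.*-identityʳ n)) (ℤ.≤-trans (i≤∣i∣ n)
        (subst (+ k ℤ.≤_) (ℤ.pos-* k (suc d-1)) (ℤ.+≤+ (ℕ.m≤m*n k (suc d-1))))))))
    k<k+1 : ι k < ι k + 1ℚ
    k<k+1 = subst (_< ι k + 1ℚ) (ℚ.+-identityʳ (ι k)) (ℚ.+-monoʳ-< (ι k) (ℚ.positive⁻¹ 1ℚ))

  step-small : ∀ ε → 0ℚ < ε → ∃ λ N → ∀ n → N ℕ.≤ n → step n < ε
  step-small ε 0<ε with divide 0<ε (ℚ.positive⁻¹ 1ℚ)
  ... | δ , _ , εδ≡1 = N , λ n N≤n → ℚ.*-cancelˡ-<-nonNeg (ι (suc n))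
      {{ℚ.nonNegative (0≤ι (suc n))}}
      (subst₂ _<_ (trans εδ≡1 (sym (ι-step n))) (ℚ.*-comm ε (ι (suc n)))
        (ℚ.*-monoʳ-<-pos ε {{ℚ.positive 0<ε}}
          (ℚ.<-≤-trans (r<ι δ) (ι-mono (ℕ.≤-trans N≤n (ℕ.n≤1+n n))))))
    where N = suc ℤ.∣ ↥ δ ∣

  square-≤ : ∀ {p q} → 0ℚ ≤ p → p ≤ q → p * p ≤ q * q
  square-≤ 0≤p p≤q = *-mono-≤-nonNeg 0≤p (ℚ.≤-trans 0≤p p≤q) p≤q p≤q

open Estimates

-- Real numbers: Cauchy sequences of rationals, considered up to _≈_.
record ℝ : Set where
  constructor mkℝ
  field
    seq    : ℕ → ℚ
    cauchy : ∀ ε → 0ℚ ℚ.< ε →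
             ∃ λ N → ∀ m n → N ℕ.≤ m → N ℕ.≤ n → ℚ.∣ seq m ℚ.- seq n ∣ ℚ.< ε

open ℝ public

infix 4 _≈_ _≤_ _<_

_≈_ : ℝ → ℝ → Set
x ≈ y = ∀ ε → 0ℚ ℚ.< ε → ∃ λ N → ∀ n → N ℕ.≤ n → ℚ.∣ seq x n ℚ.- seq y n ∣ ℚ.< ε

_≤_ : ℝ → ℝ → Set
x ≤ y = ∀ ε → 0ℚ ℚ.< ε → ∃ λ N → ∀ n → N ℕ.≤ n → seq x n ℚ.≤ seq y n ℚ.+ ε

_<_ : ℝ → ℝ → Set
x < y = ∃ λ ε → 0ℚ ℚ.< ε × ∃ λ N → ∀ n → N ℕ.≤ n → seq x n ℚ.+ ε ℚ.≤ seq y n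

fromℚ : ℚ → ℝ
fromℚ r = mkℝ (λ _ → r) λ ε 0<ε → 0 , λ _ _ _ _ →
  subst (ℚ._< ε) (sym (cong ℚ.∣_∣ (ℚ.+-inverseʳ r))) 0<ε

0ℝ 1ℝ : ℝ
0ℝ = fromℚ 0ℚ
1ℝ = fromℚ 1ℚ

infix  8 -_
infixl 6 _+_ _-_
infixl 7 _*_

_+_ : ℝ → ℝ → ℝ
x + y = mkℝ (λ n → seq x n ℚ.+ seq y n) λ ε 0<ε →
  let (M , hM) = cauchy x (half ε) (half-pos 0<ε)
      (N , hN) = cauchy y (half ε) (half-pos 0<ε)
  in M ℕ.⊔ N , λ m n ≤m ≤n →
    subst (λ t → ℚ.∣ t ∣ ℚ.< ε) (lem (seq x m) (seq x n) (seq y m) (seq y n))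
      (ℚ.≤-<-trans (ℚ.∣p+q∣≤∣p∣+∣q∣ (seq x m ℚ.- seq x n) (seq y m ℚ.- seq y n))
        (<-half ε (hM m n (ℕ.m⊔n≤o⇒m≤o M N ≤m) (ℕ.m⊔n≤o⇒m≤o M N ≤n))
                  (hN m n (ℕ.m⊔n≤o⇒n≤o M N ≤m) (ℕ.m⊔n≤o⇒n≤o M N ≤n))))
  where
  lem : ∀ a b c d → (a ℚ.- b) ℚ.+ (c ℚ.- d) ≡ (a ℚ.+ c) ℚ.- (b ℚ.+ d)
  lem = solve 4 (λ a b c d → (a :- b) :+ (c :- d) := (a :+ c) :- (b :+ d)) refl
    where open +-*-Solver

-_ : ℝ → ℝ
- x = mkℝ (λ n → ℚ.- seq x n) λ ε 0<ε →
  let (N , h) = cauchy x ε 0<ε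
  in N , λ m n ≤m ≤n → subst (ℚ._< ε)
       (trans (sym (ℚ.∣-p∣≡∣p∣ (seq x m ℚ.- seq x n)))
              (cong ℚ.∣_∣ (ℚ.neg-distrib-+ (seq x m) (ℚ.- seq x n))))
       (h m n ≤m ≤n)

_-_ : ℝ → ℝ → ℝ
x - y = x + (- y)

eventually-bounded : ∀ x → ∃ λ K → 0ℚ ℚ.< K × ∃ λ N → ∀ n → N ℕ.≤ n → ℚ.∣ seq x n ∣ ℚ.≤ K
eventually-bounded x =
  let (N , h) = cauchy x 1ℚ (ℚ.positive⁻¹ 1ℚ)
  in ℚ.∣ seq x N ∣ ℚ.+ 1ℚ
   , ℚ.+-mono-≤-< (ℚ.0≤∣p∣ (seq x N)) (ℚ.positive⁻¹ 1ℚ)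
   , N , λ n N≤n → ℚ.<⇒≤ (∣p∣<∣q∣+ε {seq x n} {seq x N} (h n N N≤n ℕ.≤-refl))

_*_ : ℝ → ℝ → ℝ
x * y = mkℝ (λ n → seq x n ℚ.* seq y n) λ ε 0<ε →
  let (K , 0<K , B , hB) = eventually-bounded x
      (L , 0<L , C , hC) = eventually-bounded y
      (δ , 0<δ , Kδ) = divide 0<K (half-pos 0<ε)
      (η , 0<η , Lη) = divide 0<L (half-pos 0<ε)
      (M , hM) = cauchy y δ 0<δ
      (N , hN) = cauchy x η 0<η
  in (B ℕ.⊔ C) ℕ.⊔ (M ℕ.⊔ N) , λ m n ≤m ≤n →
    let ≤B = ℕ.m⊔n≤o⇒m≤o B C (ℕ.m⊔n≤o⇒m≤o (B ℕ.⊔ C) (M ℕ.⊔ N) ≤m)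
        ≤C = ℕ.m⊔n≤o⇒n≤o B C (ℕ.m⊔n≤o⇒m≤o (B ℕ.⊔ C) (M ℕ.⊔ N) ≤n)
        m≥ = ℕ.m⊔n≤o⇒n≤o (B ℕ.⊔ C) (M ℕ.⊔ N) ≤m
        n≥ = ℕ.m⊔n≤o⇒n≤o (B ℕ.⊔ C) (M ℕ.⊔ N) ≤n
    in subst (λ t → ℚ.∣ t ∣ ℚ.< ε) (lem (seq x m) (seq x n) (seq y m) (seq y n))
      (ℚ.≤-<-trans
        (ℚ.∣p+q∣≤∣p∣+∣q∣ (seq x m ℚ.* (seq y m ℚ.- seq y n)) (seq y n ℚ.* (seq x m ℚ.- seq x n)))
        (<-half ε
          (bound {seq x m} 0<K Kδ (hB m ≤B)
            (hM m n (ℕ.m⊔n≤o⇒m≤o M N m≥) (ℕ.m⊔n≤o⇒m≤o M N n≥)))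
          (bound {seq y n} 0<L Lη (hC n ≤C)
            (hN m n (ℕ.m⊔n≤o⇒n≤o M N m≥) (ℕ.m⊔n≤o⇒n≤o M N n≥)))))
  where
  lem : ∀ a b c d → a ℚ.* (c ℚ.- d) ℚ.+ d ℚ.* (a ℚ.- b) ≡ a ℚ.* c ℚ.- b ℚ.* d
  lem = solve 4 (λ a b c d → a :* (c :- d) :+ d :* (a :- b) := a :* c :- b :* d) refl
    where open +-*-Solver

  bound : ∀ {a b K δ ε} → 0ℚ ℚ.< K → K ℚ.* δ ≡ ε →
          ℚ.∣ a ∣ ℚ.≤ K → ℚ.∣ b ∣ ℚ.< δ → ℚ.∣ a ℚ.* b ∣ ℚ.< ε
  bound {a} {b} {K} {δ} 0<K refl ∣a∣≤K ∣b∣<δ = subst (ℚ._< K ℚ.* δ) (sym (ℚ.∣p*q∣≡∣p∣*∣q∣ a b))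
    (ℚ.≤-<-trans (ℚ.*-monoʳ-≤-nonNeg ℚ.∣ b ∣ {{ℚ.∣-∣-nonNeg b}} ∣a∣≤K)
                 (ℚ.*-monoʳ-<-pos K {{ℚ.positive 0<K}} ∣b∣<δ))

∣_∣ : ℝ → ℝ
∣ x ∣ = mkℝ (λ n → ℚ.∣ seq x n ∣) λ ε 0<ε →
  let (N , h) = cauchy x ε 0<ε
  in N , λ m n ≤m ≤n → ∣-∣-two-sided
       (∣p∣<∣q∣+ε {seq x m} {seq x n} (h m n ≤m ≤n))
       (∣p∣<∣q∣+ε {seq x n} {seq x m} (h n m ≤n ≤m))

grid : ℕ → ℕ → ℚ
grid n s = ι s ℚ.* step n

search : ℚ → ℕ → ℕ → ℕ
search r n zero = zero
search r n (suc k) =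
  if does (grid n (suc k) ℚ.* grid n (suc k) ℚ.≤? r) then suc k else search r n k

-- The largest t = s/(n+1), s ∈ ℕ, with t² ≤ r; it is 0 if r < 0.
approx-√ : ℚ → ℕ → ℚ
approx-√ r n = grid n (search r n (suc n ℕ.* suc ℤ.∣ ↥ r ∣))

approx-√-lower : ∀ r n → approx-√ r n ≡ 0ℚ ⊎ approx-√ r n ℚ.* approx-√ r n ℚ.≤ r
approx-√-lower r n = go (suc n ℕ.* suc ℤ.∣ ↥ r ∣)
  where
  Lower : ℕ → Set
  Lower s = grid n s ≡ 0ℚ ⊎ grid n s ℚ.* grid n s ℚ.≤ r

  choose : ∀ s {t} (d : Dec (grid n s ℚ.* grid n s ℚ.≤ r)) →
           Lower t → Lower (if does d then s else t)
  choose _ (yes h) _ = inj₂ h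
  choose _ (no  _) l = l

  go : ∀ k → Lower (search r n k)
  go zero    = inj₁ (ℚ.*-zeroˡ (step n))
  go (suc k) = choose (suc k) (grid n (suc k) ℚ.* grid n (suc k) ℚ.≤? r) (go k)

approx-√-upper : ∀ r n → let t = approx-√ r n ℚ.+ step n in r ℚ.< t ℚ.* t
approx-√-upper r n = subst (λ t → r ℚ.< t ℚ.* t) (grid-suc (search r n K)) (go K start)
  where
  c = suc ℤ.∣ ↥ r ∣
  K = suc n ℕ.* c

  grid-suc : ∀ s → grid n (suc s) ≡ grid n s ℚ.+ step n
  grid-suc s = trans (cong (ℚ._* step n) (ι-suc s))
    (trans (ℚ.*-distribʳ-+ (step n) (ι s) 1ℚ) (cong (grid n s ℚ.+_) (ℚ.*-identityˡ (step n))))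

  Upper : ℕ → Set
  Upper s = r ℚ.< grid n (suc s) ℚ.* grid n (suc s)

  choose : ∀ s {t} (d : Dec (grid n s ℚ.* grid n s ℚ.≤ r)) →
           Upper s → (r ℚ.< grid n s ℚ.* grid n s → Upper t) → Upper (if does d then s else t)
  choose _ (yes _) u _ = u
  choose _ (no  h) _ f = f (ℚ.≰⇒> h)

  go : ∀ k → Upper k → Upper (search r n k)
  go zero    u = u
  go (suc k) u = choose (suc k) (grid n (suc k) ℚ.* grid n (suc k) ℚ.≤? r) u (go k)

  grid-K : grid n K ≡ ι c
  grid-K = trans (cong (ℚ._* step n) (ι-* (suc n) c))
    (trans (solve 3 (λ a b s → a :* b :* s := b :* (a :* s)) refl (ι (suc n)) (ι c) (step n))
      (trans (cong (ι c ℚ.*_) (ι-step n)) (ℚ.*-identityʳ (ι c))))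
    where open +-*-Solver

  start : r ℚ.< grid n (suc K) ℚ.* grid n (suc K)
  start = begin-strict
    r                                ≤⟨ ℚ.<⇒≤ (r<ι r) ⟩
    ι c                              ≡⟨ ℚ.*-identityʳ (ι c) ⟨
    ι c ℚ.* 1ℚ                       ≤⟨ ℚ.*-monoˡ-≤-nonNeg (ι c) {{ℚ.nonNegative (0≤ι c)}}
                                          (ι-mono {1} {c} (ℕ.s≤s ℕ.z≤n)) ⟩
    ι c ℚ.* ι c                      <⟨ ℚ.*-monoʳ-<-pos (ι c) {{ℚ.normalize-pos c 1}} ιc<g ⟩
    ι c ℚ.* g                        ≤⟨ ℚ.*-monoʳ-≤-nonNeg g {{ℚ.nonNegative 0≤g}} (ℚ.<⇒≤ ιc<g) ⟩
    g ℚ.* g                          ∎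
    where
    open ℚ.≤-Reasoning
    g = grid n (suc K)
    ιc<g : ι c ℚ.< g
    ιc<g = subst₂ ℚ._<_ (trans (ℚ.+-identityʳ (grid n K)) grid-K) (sym (grid-suc K))
             (ℚ.+-monoʳ-< (grid n K) (step-pos n))
    0≤g : 0ℚ ℚ.≤ g
    0≤g = ℚ.≤-trans (0≤ι c) (ℚ.<⇒≤ ιc<g)

approx-√-nonNeg : ∀ r n → 0ℚ ℚ.≤ approx-√ r n
approx-√-nonNeg r n = subst (ℚ._≤ approx-√ r n) (ℚ.*-zeroˡ (step n))
  (ℚ.*-monoʳ-≤-nonNeg (step n) {{ℚ.nonNegative (ℚ.<⇒≤ (step-pos n))}} (0≤ι s))
  where s = search r n (suc n ℕ.* suc ℤ.∣ ↥ r ∣)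

-- Square root, with the convention √ x ≈ 0 for x ≤ 0.
√ : ℝ → ℝ
√ x = mkℝ (λ n → approx-√ (seq x n) n) λ ε 0<ε →
  let η = half ε
      0<η = half-pos 0<ε
      (M , hM) = cauchy x (η ℚ.* η) (pos-* 0<η 0<η)
      (N , hN) = step-small η 0<η
  in M ℕ.⊔ N , λ m n ≤m ≤n →
    let m≥M = ℕ.m⊔n≤o⇒m≤o M N ≤m
        n≥M = ℕ.m⊔n≤o⇒m≤o M N ≤n
        r = seq x m
        s = seq x n
    in ∣-∣-two-sided {approx-√ r m} {approx-√ s n}
         (below r s m n ε 0<ε (∣-∣-one-sided {r} {s} (hM m n m≥M n≥M)) (hN n (ℕ.m⊔n≤o⇒n≤o M N ≤n)))
         (below s r n m ε 0<ε (∣-∣-one-sided {s} {r} (hM n m n≥M m≥M)) (hN m (ℕ.m⊔n≤o⇒n≤o M N ≤m)))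
  where
  below : ∀ r s m n ε → 0ℚ ℚ.< ε → r ℚ.< s ℚ.+ half ε ℚ.* half ε → step n ℚ.< half ε →
          approx-√ r m ℚ.< approx-√ s n ℚ.+ ε
  below r s m n ε 0<ε r<s+ηη step<η =
    ℚ.≰⇒> λ h → absurd h (approx-√-lower r m)
    where
    open ℚ.≤-Reasoning
    open +-*-Solver using (solve; _:+_; _:*_; _:=_)
    a = approx-√ r m
    b = approx-√ s n
    η = half ε
    0<η = half-pos 0<ε
    u = b ℚ.+ step n
    0≤b = approx-√-nonNeg s n
    0<u : 0ℚ ℚ.< u
    0<u = ℚ.+-mono-≤-< 0≤b (step-pos n)
    u+η≤a : b ℚ.+ ε ℚ.≤ a → u ℚ.+ η ℚ.≤ a
    u+η≤a h = begin
      b ℚ.+ step n ℚ.+ η ≤⟨ ℚ.+-monoˡ-≤ η (ℚ.+-monoʳ-≤ b (ℚ.<⇒≤ step<η)) ⟩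
      b ℚ.+ η ℚ.+ η      ≡⟨ ℚ.+-assoc b η η ⟩
      b ℚ.+ (η ℚ.+ η)    ≡⟨ cong (b ℚ.+_) (half+half ε) ⟩
      b ℚ.+ ε            ≤⟨ h ⟩
      a                  ∎
    0<u+η : 0ℚ ℚ.< u ℚ.+ η
    0<u+η = pos-+ 0<u 0<η
    absurd : b ℚ.+ ε ℚ.≤ a → a ≡ 0ℚ ⊎ a ℚ.* a ℚ.≤ r → ⊥
    absurd h (inj₁ a≡0) = ℚ.<-irrefl (sym a≡0) (ℚ.<-≤-trans 0<u+η (u+η≤a h))
    absurd h (inj₂ aa≤r) = ℚ.<-irrefl refl (begin-strict
      r                                              <⟨ r<s+ηη ⟩
      s ℚ.+ η ℚ.* η                                  <⟨ ℚ.+-monoˡ-< (η ℚ.* η) (approx-√-upper s n) ⟩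
      u ℚ.* u ℚ.+ η ℚ.* η                            ≡⟨ ℚ.+-identityʳ (u ℚ.* u ℚ.+ η ℚ.* η) ⟨
      u ℚ.* u ℚ.+ η ℚ.* η ℚ.+ 0ℚ                     ≤⟨ ℚ.+-monoʳ-≤ (u ℚ.* u ℚ.+ η ℚ.* η)
                                                          (ℚ.<⇒≤ (pos-+ 0<uη 0<uη)) ⟩
      u ℚ.* u ℚ.+ η ℚ.* η ℚ.+ (u ℚ.* η ℚ.+ u ℚ.* η)  ≡⟨ solve 2 (λ u η → u :* u :+ η :* η :+ (u :* η :+ u :* η)
                                                          := (u :+ η) :* (u :+ η)) refl u η ⟩
      (u ℚ.+ η) ℚ.* (u ℚ.+ η)                        ≤⟨ square-≤ (ℚ.<⇒≤ 0<u+η) (u+η≤a h) ⟩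
      a ℚ.* a                                        ≤⟨ aa≤r ⟩
      r                                              ∎)
      where
      0<uη = pos-* 0<u 0<η

infix 4 _=o_

_=o_ : (ℕ → ℝ) → (ℕ → ℝ) → Set
f =o g = ∀ ε → 0ℝ < ε → ∃ λ N → ∀ n → N ℕ.≤ n → ∣ f n ∣ ≤ ε * ∣ g n ∣

-- 1 / n^1.5 = √ (1 / n³), with the junk value 0 at n = 0.
1/n^1·5 : ℕ → ℝ
1/n^1·5 zero      = 0ℝ
1/n^1·5 n@(suc _) = √ (fromℚ ((+ 1 ℚ./ (n ℕ.^ 3)) {{ℕ.m^n≢0 n 3}}))

Point : ℕ → Set
Point d = Vector.Vector ℝ d

_≈ᵖ_ : ∀ {d} → Point d → Point d → Set
x ≈ᵖ y = ∀ i → x i ≈ y i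

norm : ∀ {d} → Point d → ℝ
norm x = √ (Vector.foldr _+_ 0ℝ (λ i → x i * x i))

dist : ∀ {d} → Point d → Point d → ℝ
dist x y = norm (λ i → x i - y i)

≈-respˡ-seq : ∀ {x y z} → (∀ n → seq x n ≡ seq y n) → x ≈ z → y ≈ z
≈-respˡ-seq {z = z} eq x≈z ε 0<ε =
  let (N , h) = x≈z ε 0<ε
  in N , λ n N≤n → subst (λ t → ℚ.∣ t ℚ.- seq z n ∣ ℚ.< ε) (eq n) (h n N≤n)

dist-sym : ∀ {d} (x y : Point d) n → seq (dist x y) n ≡ seq (dist y x) n
dist-sym x y n = cong (λ r → approx-√ r n) (sums x y)
  where
  sums : ∀ {d} (x y : Point d) →
         seq (Vector.foldr _+_ 0ℝ (λ i → (x i - y i) * (x i - y i))) n ≡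
         seq (Vector.foldr _+_ 0ℝ (λ i → (y i - x i) * (y i - x i))) n
  sums {zero}  x y = refl
  sums {suc d} x y = cong₂ ℚ._+_
    (solve 2 (λ a b → (a :- b) :* (a :- b) := (b :- a) :* (b :- a)) refl
      (seq (x zero) n) (seq (y zero) n))
    (sums (x ∘ suc) (y ∘ suc))
    where open +-*-Solver

-- A finite set of m points of ℝᵈ is an enumeration of it without repetitions.
record PointSet (d m : ℕ) : Set where
  field
    point    : Fin m → Point d
    distinct : ∀ {i j} → point i ≈ᵖ point j → i ≡ j

open PointSet public

IsDiameter : ∀ {d m} → PointSet d m → ℝ → Set
IsDiameter V δ = (∃ λ i → ∃ λ j → dist (point V i) (point V j) ≈ δ)
               × (∀ i j → dist (point V i) (point V j) ≤ δ)

record Graph : Set₁ where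
  field
    Vertex : Set
    _~_    : Vertex → Vertex → Set
    ~-sym    : ∀ {u v} → u ~ v → v ~ u
    ~-irrefl : ∀ {v} → ¬ (v ~ v)

record _≅_ (G H : Graph) : Set where
  private
    module G = Graph G
    module H = Graph H
  field
    bijection : G.Vertex ↔ H.Vertex
    adjacency : ∀ u v → (u G.~ v) ⇔ (Inverse.to bijection u H.~ Inverse.to bijection v)

Colourable : Graph → ℕ → Set
Colourable G c = ∃ λ (f : Vertex → Fin c) → ∀ u v → u ~ v → f u ≢ f v
  where open Graph G

HasChromaticNumber : Graph → ℕ → Set
HasChromaticNumber G χ = Colourable G χ × (∀ c → Colourable G c → χ ℕ.≤ c)

Connected : Graph → Set
Connected G = ∀ u v → Star _~_ u v
  where open Graph G

diameterGraph : ∀ {d m} → PointSet d m → ℝ → Graph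
diameterGraph {m = m} V δ = record
  { Vertex   = Fin m
  ; _~_      = λ i j → i ≢ j × dist (point V i) (point V j) ≈ δ
  ; ~-sym    = λ {i} {j} (i≢j , h) → i≢j ∘ sym ,
      ≈-respˡ-seq {dist (point V i) (point V j)} {dist (point V j) (point V i)} {δ}
        (dist-sym (point V i) (point V j)) h
  ; ~-irrefl = λ (i≢i , _) → i≢i refl
  }

IsDiameterGraph : ℕ → Graph → Set
IsDiameterGraph d G = ∃ λ m → Σ (PointSet d m) λ V → ∃ λ δ →
  IsDiameter V δ × G ≅ diameterGraph V δ

-- Graphs on the vertex set Fin n. In N ▹ G the vertex zero has neighbourhood N
-- among the remaining vertices, and G is the graph they induce; so each graph
-- is represented exactly once.
infixr 5 _▹_

data LabelledGraph : ℕ → Set where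
  ∅   : LabelledGraph 0
  _▹_ : ∀ {n} → Subset n → LabelledGraph n → LabelledGraph (suc n)

Adjacent : ∀ {n} → LabelledGraph n → Fin n → Fin n → Set
Adjacent (N ▹ G) zero    zero    = ⊥
Adjacent (N ▹ G) zero    (suc j) = j ∈ N
Adjacent (N ▹ G) (suc i) zero    = i ∈ N
Adjacent (N ▹ G) (suc i) (suc j) = Adjacent G i j

Adjacent-sym : ∀ {n} (G : LabelledGraph n) i j → Adjacent G i j → Adjacent G j i
Adjacent-sym (N ▹ G) zero    (suc j) h = h
Adjacent-sym (N ▹ G) (suc i) zero    h = h
Adjacent-sym (N ▹ G) (suc i) (suc j) h = Adjacent-sym G i j h

Adjacent-irrefl : ∀ {n} (G : LabelledGraph n) i → ¬ Adjacent G i i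
Adjacent-irrefl (N ▹ G) zero    ()
Adjacent-irrefl (N ▹ G) (suc i) h = Adjacent-irrefl G i h

_[_] : ∀ {n} → LabelledGraph n → Subset n → Graph
G [ W ] = record
  { Vertex   = ∃ λ v → v ∈ W
  ; _~_      = λ (u , _) (v , _) → Adjacent G u v
  ; ~-sym    = λ {(u , _)} {(v , _)} → Adjacent-sym G u v
  ; ~-irrefl = λ {(v , _)} → Adjacent-irrefl G v
  }

allSubsets : ∀ n → List (Subset n)
allSubsets zero    = [] ∷ []
allSubsets (suc n) = List.cartesianProductWith _∷_ (inside ∷ outside ∷ []) (allSubsets n)

allGraphs : ∀ n → List (LabelledGraph n)
allGraphs zero    = ∅ ∷ []
allGraphs (suc n) = List.cartesianProductWith _▹_ (allSubsets n) (allGraphs n)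

-- The probability of a single graph: a factor p for each edge and 1 - p for
-- each non-edge.
weight : ∀ {n} → ℝ → LabelledGraph n → ℝ
weight p ∅       = 1ℝ
weight p (N ▹ G) = Vec.foldr _ (λ b w → (if b then p else 1ℝ - p) * w) 1ℝ N * weight p G

ℙ : (n : ℕ) → ℝ → (LabelledGraph n → Bool) → ℝ
ℙ n p S = List.foldr _+_ 0ℝ (List.map (weight p) (List.filterᵇ S (allGraphs n)))

-- ℙ_{n,p}(A) > c for a property A of graphs that need not be constructively
-- decidable: some set S of graphs contained in A has probability > c. The
-- sample space is finite and ℙ is monotone, so if A is decidable (classically:
-- always) this says that the probability of A itself exceeds c.
ProbabilityExceeds : (n : ℕ) → ℝ → (LabelledGraph n → Set) → ℝ → Set
ProbabilityExceeds n p A c =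
  ∃ λ (S : LabelledGraph n → Bool) → (∀ G → T (S G) → A G) × c < ℙ n p S

IsLargestPositive : (ℕ → Set) → ℕ → Set
IsLargestPositive P k = 0 ℕ.< k × P k × (∀ j → P j → j ℕ.≤ k)

IsLargestPositiveOr0 : (ℕ → Set) → ℕ → Set
IsLargestPositiveOr0 P k = IsLargestPositive P k ⊎ (k ≡ 0 × (∀ j → 0 ℕ.< j → ¬ P j))

HasDiameterSubgraph HasDiameterSubgraph′ : ℕ → ℕ → ∀ {n} → LabelledGraph n → Set
HasDiameterSubgraph d k G = ∃ λ W → card W ≡ k
  × IsDiameterGraph d (G [ W ]) × HasChromaticNumber (G [ W ]) (suc d)
HasDiameterSubgraph′ d k G = ∃ λ W → card W ≡ k
  × IsDiameterGraph d (G [ W ]) × HasChromaticNumber (G [ W ]) (suc d) × Connected (G [ W ])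

-- Is-u d n p k says that u_d(n,p) = k, and Is-u′ d n p k that u'_d(n,p) = k;
-- by Is-u-unique and Is-u′-unique there is at most one such k.
Is-u Is-u′ : (d n : ℕ) → ℝ → ℕ → Set
Is-u  d n p = IsLargestPositiveOr0 λ k → ProbabilityExceeds n p (HasDiameterSubgraph  d k) (fromℚ ½)
Is-u′ d n p = IsLargestPositiveOr0 λ k → ProbabilityExceeds n p (HasDiameterSubgraph′ d k) (fromℚ ½)

largest-unique : ∀ {P k l} → IsLargestPositiveOr0 P k → IsLargestPositiveOr0 P l → k ≡ l
largest-unique (inj₁ (_ , Pk , k-max)) (inj₁ (_ , Pl , l-max)) = ℕ.≤-antisym (l-max _ Pk) (k-max _ Pl)
largest-unique (inj₁ (0<k , Pk , _))   (inj₂ (_ , none))       = ⊥-elim (none _ 0<k Pk)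
largest-unique (inj₂ (_ , none))       (inj₁ (0<l , Pl , _))   = ⊥-elim (none _ 0<l Pl)
largest-unique (inj₂ (refl , _))       (inj₂ (refl , _))       = refl

Is-u-unique : ∀ d n p {k l} → Is-u d n p k → Is-u d n p l → k ≡ l
Is-u-unique _ _ _ = largest-unique

Is-u′-unique : ∀ d n p {k l} → Is-u′ d n p k → Is-u′ d n p l → k ≡ l
Is-u′-unique _ _ _ = largest-unique

{-# OPTIONS --safe #-}
module Submission where

-- The expected number of pairs of non-edges with a common vertex is at most
-- n³q² → 0, so with probability at least 3/4 the complement of the random graph
-- is a matching. Such a graph with n ≥ 5 contains a triangle, realised in the
-- plane by an equilateral one. Conversely, let W with |W| ≥ 4 induce a subgraph
-- of chromatic number 3. If it had no triangle, colouring each vertex by its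
-- adjacency to a fixed vertex would be proper with two colours; so there is a
-- triangle, a fourth vertex is adjacent to at least two of its vertices, and a
-- diameter graph would contain two triangles with a common edge. In the plane
-- the remaining two vertices would then be √3 diameters apart. Finally, two
-- events of probability > 1/2 intersect, which bounds u₂ from above.

open import Data.Bool using (Bool; true; false; if_then_else_; T)
open import Data.Empty using (⊥; ⊥-elim)
open import Data.Fin as Fin using (Fin; zero; suc)
import Data.Fin.Properties as Fin
open import Data.Fin.Subset as Subset using (Subset; _∈_; inside; outside) renaming (∣_∣ to card)
import Data.Fin.Subset.Properties as Subset
open import Data.Integer using (+_)
open import Data.List as List using (List; []; _∷_)
open import Data.Nat as ℕ using (ℕ; zero; suc)
import Data.Nat.Properties as ℕ
open import Data.Product using (∃; _×_; _,_; proj₁; proj₂)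
open import Data.Rational as ℚ using (ℚ; 0ℚ; 1ℚ; ½)
import Data.Rational.Properties as ℚ
open import Data.Rational.Solver using (module +-*-Solver)
open import Data.Sum as Sum using (_⊎_; inj₁; inj₂)
open import Data.Unit using (tt)
open import Data.Vec as Vec using ([]; _∷_; here; there; _[_]≔_)
import Data.Vec.Functional as Vector
import Data.Vec.Properties as Vec
import Data.Vec.Properties.WithK as Vec
open import Function using (_∘_)
open import Function.Bundles using (_↔_; Inverse; Injection; Equivalence; mk⇔; mk↔ₛ′)
open import Function.Properties.Inverse using (↔⇒↣)
import Relation.Binary.Construct.Closure.ReflexiveTransitive as Star
open import Relation.Binary.PropositionalEquality
  using (_≡_; _≢_; refl; sym; trans; cong; cong₂; subst; subst₂; module ≡-Reasoning)
open import Relation.Nullary using (¬_; Dec; yes; no)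
open import Relation.Nullary.Decidable using (from-no)
import Defs
open Defs.Estimates

-- Two obstacles shape the formalisation. Being a diameter graph is not decided, so an event is a
-- Boolean set of graphs contained in the property. The decidable event `cherryFree` therefore does
-- double duty: it witnesses the lower bounds, and for the upper bounds it must meet every competing
-- Boolean set. Reals are Cauchy sequences whose order and equality speak of tails only.
-- Probabilities are computed index by index, as rational expectations with the m-th approximation
-- of p as edge probability. Such an approximation may leave [0, 1], so p is first replaced by an
-- equal real whose approximations stay inside. In the plane √3 is never computed. The coordinates
-- are eliminated by a polynomial identity between squared distances, namely a product that must
-- vanish. Which factor vanishes cannot be decided, but the goal is a contradiction, so it is enough
-- to refute each factor.

module Rationals where
  open import Data.Rational using (_+_; _*_; _-_; -_; _<_; _≤_; ∣_∣)

  -- Splits a polynomial inequality into an explicit nonnegative difference and an identity for the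
  -- ring solver.
  ≤-by-difference : ∀ {p q} d → 0ℚ ≤ d → p + d ≡ q → p ≤ q
  ≤-by-difference {p} d 0≤d refl = subst (_≤ p + d) (ℚ.+-identityʳ p) (ℚ.+-monoʳ-≤ p 0≤d)

  0≤+ : ∀ {p q} → 0ℚ ≤ p → 0ℚ ≤ q → 0ℚ ≤ p + q
  0≤+ 0≤p 0≤q = ℚ.+-mono-≤ 0≤p 0≤q

  0≤* : ∀ {p q} → 0ℚ ≤ p → 0ℚ ≤ q → 0ℚ ≤ p * q
  0≤* {p} {q} 0≤p 0≤q = ℚ.nonNegative⁻¹ (p * q)
    {{ℚ.nonNeg*nonNeg⇒nonNeg p {{ℚ.nonNegative 0≤p}} q {{ℚ.nonNegative 0≤q}}}}

  p≤q⇒0≤q-p : ∀ {p q} → p ≤ q → 0ℚ ≤ q - p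
  p≤q⇒0≤q-p {p} {q} p≤q = subst (_≤ q - p) (ℚ.+-inverseʳ p) (ℚ.+-monoˡ-≤ (- p) p≤q)

  *-monoˡ : ∀ {p q} r → 0ℚ ≤ r → p ≤ q → r * p ≤ r * q
  *-monoˡ r 0≤r = ℚ.*-monoˡ-≤-nonNeg r {{ℚ.nonNegative 0≤r}}

  *-monoʳ : ∀ {p q} r → 0ℚ ≤ r → p ≤ q → p * r ≤ q * r
  *-monoʳ r 0≤r = ℚ.*-monoʳ-≤-nonNeg r {{ℚ.nonNegative 0≤r}}

  ∣p∣²≡p² : ∀ p → ∣ p ∣ * ∣ p ∣ ≡ p * p
  ∣p∣²≡p² p with ℚ.∣p∣≡p∨∣p∣≡-p p
  ... | inj₁ eq = cong₂ _*_ eq eq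
  ... | inj₂ eq = trans (cong₂ _*_ eq eq) (solve 1 (λ p → (:- p) :* (:- p) := p :* p) refl p)
    where open +-*-Solver

  0≤p² : ∀ p → 0ℚ ≤ p * p
  0≤p² p = subst (0ℚ ≤_) (∣p∣²≡p² p) (0≤* (ℚ.0≤∣p∣ p) (ℚ.0≤∣p∣ p))

  p²<q²⇒∣p∣<q : ∀ {p q} → 0ℚ ≤ q → p * p < q * q → ∣ p ∣ < q
  p²<q²⇒∣p∣<q {p} {q} 0≤q p²<q² = ℚ.≰⇒> λ q≤∣p∣ →
    ℚ.<-irrefl refl (ℚ.<-≤-trans p²<q² (subst (q * q ≤_) (∣p∣²≡p² p) (square-≤ 0≤q q≤∣p∣)))

  0<½ : 0ℚ < ½
  0<½ = ℚ.positive⁻¹ ½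

  half< : ∀ {ε} → 0ℚ < ε → half ε < ε
  half< {ε} 0<ε = subst₂ _<_ (ℚ.+-identityʳ (half ε)) (half+half ε)
    (ℚ.+-monoʳ-< (half ε) (half-pos 0<ε))

open Rationals

-- Eventual properties and null sequences of rationals

Eventually : (ℕ → Set) → Set
Eventually P = ∃ λ N → ∀ n → N ℕ.≤ n → P n

always : ∀ {P : ℕ → Set} → (∀ n → P n) → Eventually P
always p = 0 , λ n _ → p n

map-ev : ∀ {P Q : ℕ → Set} → (∀ n → P n → Q n) → Eventually P → Eventually Q
map-ev f (N , p) = N , λ n N≤n → f n (p n N≤n)

zip-ev : ∀ {P Q R : ℕ → Set} → (∀ n → P n → Q n → R n) →
         Eventually P → Eventually Q → Eventually R
zip-ev f (M , p) (N , q) = M ℕ.⊔ N , λ n h →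
  f n (p n (ℕ.m⊔n≤o⇒m≤o M N h)) (q n (ℕ.m⊔n≤o⇒n≤o M N h))

Null : (ℕ → ℚ) → Set
Null f = ∀ ε → 0ℚ ℚ.< ε → Eventually λ n → ℚ.∣ f n ∣ ℚ.< ε

module NullSequences where
  open import Data.Rational using (_+_; _*_; _-_; -_; _<_; _≤_; ∣_∣)

  null-resp : ∀ {f g : ℕ → ℚ} → (∀ n → f n ≡ g n) → Null f → Null g
  null-resp eq null ε 0<ε = map-ev (λ n → subst (λ t → ∣ t ∣ < ε) (eq n)) (null ε 0<ε)

  null-dominated : ∀ {f g : ℕ → ℚ} → Eventually (λ n → ∣ f n ∣ ≤ ∣ g n ∣) → Null g → Null f
  null-dominated f≤g null ε 0<ε = zip-ev (λ n → ℚ.≤-<-trans) f≤g (null ε 0<ε)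

  null-+ : ∀ {f g : ℕ → ℚ} → Null f → Null g → Null (λ n → f n + g n)
  null-+ {f} {g} f→0 g→0 ε 0<ε = zip-ev
    (λ n f< g< → ℚ.≤-<-trans (ℚ.∣p+q∣≤∣p∣+∣q∣ (f n) (g n)) (<-half ε f< g<))
    (f→0 (half ε) (half-pos 0<ε)) (g→0 (half ε) (half-pos 0<ε))

  null-neg : ∀ {f} → Null f → Null (λ n → - f n)
  null-neg {f} = null-dominated (always λ n → ℚ.≤-reflexive (ℚ.∣-p∣≡∣p∣ (f n)))

  null-bounded-* : ∀ {f g : ℕ → ℚ} {K} → 0ℚ < K → Eventually (λ n → ∣ f n ∣ ≤ K) → Null g →
                   Null (λ n → f n * g n)
  null-bounded-* {f} {g} {K} 0<K f≤K g→0 ε 0<ε with divide 0<K 0<ε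
  ... | δ , 0<δ , refl = zip-ev (λ n → bound n) f≤K (g→0 δ 0<δ)
    where
    bound : ∀ n → ∣ f n ∣ ≤ K → ∣ g n ∣ < δ → ∣ f n * g n ∣ < K * δ
    bound n f≤ g< = subst (_< K * δ) (sym (ℚ.∣p*q∣≡∣p∣*∣q∣ (f n) (g n)))
      (ℚ.≤-<-trans (*-monoʳ ∣ g n ∣ (ℚ.0≤∣p∣ (g n)) f≤)
                   (ℚ.*-monoʳ-<-pos K {{ℚ.positive 0<K}} g<))

  null-step : Null step
  null-step ε 0<ε = map-ev
    (λ n → subst (_< ε) (sym (ℚ.0≤p⇒∣p∣≡p (ℚ.<⇒≤ (step-pos n))))) (step-small ε 0<ε)

open NullSequences

-- Reals up to equality, and their square roots

open import Defs

-- Real arithmetic acts termwise, so this reduces ring identities between reals to identities of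
-- rationals at each index.
≐⇒≈ : ∀ {x y} → (∀ n → seq x n ≡ seq y n) → x ≈ y
≐⇒≈ {x} {y} eq ε 0<ε = always λ n →
  subst (ℚ._< ε) (sym (cong ℚ.∣_∣ (trans (cong (ℚ._- seq y n) (eq n)) (ℚ.+-inverseʳ (seq y n))))) 0<ε

≈-refl : ∀ {x} → x ≈ x
≈-refl {x} = ≐⇒≈ {x} {x} λ _ → refl

≈-sym : ∀ {x y} → x ≈ y → y ≈ x
≈-sym {x} {y} x≈y ε 0<ε =
  map-ev (λ n → subst (ℚ._< ε) (∣-∣-swap (seq x n) (seq y n))) (x≈y ε 0<ε)

≈-trans : ∀ {x y z} → x ≈ y → y ≈ z → x ≈ z
≈-trans {x} {y} {z} x≈y y≈z = null-resp
  (λ n → solve 3 (λ a b c → (a :- b) :+ (b :- c) := a :- c) refl (seq x n) (seq y n) (seq z n))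
  (null-+ x≈y y≈z)
  where open +-*-Solver

+-cong : ∀ {x x′ y y′} → x ≈ x′ → y ≈ y′ → x + y ≈ x′ + y′
+-cong {x} {x′} {y} {y′} x≈x′ y≈y′ = null-resp
  (λ n → solve 4 (λ a b c d → (a :- b) :+ (c :- d) := (a :+ c) :- (b :+ d)) refl
    (seq x n) (seq x′ n) (seq y n) (seq y′ n))
  (null-+ x≈x′ y≈y′)
  where open +-*-Solver

neg-cong : ∀ {x y} → x ≈ y → - x ≈ - y
neg-cong {x} {y} x≈y = null-resp
  (λ n → solve 2 (λ a b → :- (a :- b) := (:- a) :- (:- b)) refl (seq x n) (seq y n))
  (null-neg x≈y)
  where open +-*-Solver

sub-cong : ∀ {x x′ y y′} → x ≈ x′ → y ≈ y′ → x - y ≈ x′ - y′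
sub-cong {x} {x′} {y} {y′} x≈x′ y≈y′ = +-cong {x} {x′} {y = - y} {y′ = - y′} x≈x′ (neg-cong {y} {y′} y≈y′)

*-cong : ∀ {x x′ y y′} → x ≈ x′ → y ≈ y′ → x * y ≈ x′ * y′
*-cong {x} {x′} {y} {y′} x≈x′ y≈y′ =
  let (K , 0<K , x≤K) = eventually-bounded x
      (L , 0<L , y′≤L) = eventually-bounded y′
  in null-resp
    (λ n → solve 4 (λ a b c d → a :* (c :- d) :+ d :* (a :- b) := a :* c :- b :* d) refl
      (seq x n) (seq x′ n) (seq y n) (seq y′ n))
    (null-+ (null-bounded-* 0<K x≤K y≈y′) (null-bounded-* 0<L y′≤L x≈x′))
  where open +-*-Solver

≈0⇒null : ∀ {x} → x ≈ 0ℝ → Null (seq x)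
≈0⇒null {x} = null-resp (λ n → ℚ.+-identityʳ (seq x n))

null⇒≈0 : ∀ {x} → Null (seq x) → x ≈ 0ℝ
null⇒≈0 {x} = null-resp (λ n → sym (ℚ.+-identityʳ (seq x n)))

fromℚ-close : ∀ {r s} → fromℚ r ≈ fromℚ s → ∀ ε → 0ℚ ℚ.< ε → ℚ.∣ r ℚ.- s ∣ ℚ.< ε
fromℚ-close r≈s ε 0<ε = let (N , h) = r≈s ε 0<ε in h N ℕ.≤-refl

0≤x⇒∣x∣≈x : ∀ {x} → 0ℝ ≤ x → ∣ x ∣ ≈ x
0≤x⇒∣x∣≈x {x} 0≤x ε 0<ε = map-ev close (0≤x (half (half ε)) (half-pos (half-pos 0<ε)))
  where
  open ℚ.≤-Reasoning
  close : ∀ n → 0ℚ ℚ.≤ seq x n ℚ.+ half (half ε) →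
          ℚ.∣ ℚ.∣ seq x n ∣ ℚ.- seq x n ∣ ℚ.< ε
  close n h with ℚ.∣p∣≡p∨∣p∣≡-p (seq x n)
  ... | inj₁ eq = subst (ℚ._< ε)
    (sym (cong ℚ.∣_∣ (trans (cong (ℚ._- seq x n) eq) (ℚ.+-inverseʳ (seq x n))))) 0<ε
  -- Here |r| - r = -2r, and the hypothesis, used at ε/4, bounds this by ε/2.
  ... | inj₂ eq = begin-strict
    ℚ.∣ ℚ.∣ r ∣ ℚ.- r ∣       ≡⟨ ℚ.0≤p⇒∣p∣≡p (p≤q⇒0≤q-p (p≤∣p∣ r)) ⟩
    ℚ.∣ r ∣ ℚ.- r             ≡⟨ cong (ℚ._- r) eq ⟩
    ℚ.- r ℚ.- r               ≤⟨ ℚ.+-mono-≤ -r≤ -r≤ ⟩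
    half (half ε) ℚ.+ half (half ε) ≡⟨ half+half (half ε) ⟩
    half ε                    <⟨ half< 0<ε ⟩
    ε                         ∎
    where
    r = seq x n
    -r≤ : ℚ.- r ℚ.≤ half (half ε)
    -r≤ = subst₂ ℚ._≤_ (ℚ.+-identityˡ (ℚ.- r)) eq′ (ℚ.+-monoˡ-≤ (ℚ.- r) h)
      where
      open +-*-Solver
      eq′ : r ℚ.+ half (half ε) ℚ.- r ≡ half (half ε)
      eq′ = solve 2 (λ r e → r :+ e :- r := e) refl r (half (half ε))

-- Stronger than `0ℝ ≤ x`, which allows terms slightly below 0. Sums of squares and values of `√`
-- have this property, and it gives the estimates for `approx-√` at every index.
NonNeg : ℝ → Set
NonNeg x = ∀ n → 0ℚ ℚ.≤ seq x n

approx-√²≤ : ∀ {r} n → 0ℚ ℚ.≤ r → approx-√ r n ℚ.* approx-√ r n ℚ.≤ r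
approx-√²≤ {r} n 0≤r = square≤ (approx-√ r n) (approx-√-lower r n)
  where
  square≤ : ∀ t → t ≡ 0ℚ ⊎ t ℚ.* t ℚ.≤ r → t ℚ.* t ℚ.≤ r
  square≤ _ (inj₁ refl) = 0≤r
  square≤ _ (inj₂ h)    = h

-- Stated for any s instead of √ x because comparing terms up to unfolding of
-- approx-√ is prohibitively expensive.
square-of-approximation : ∀ {s x} (t : ℕ → ℚ) → (∀ n → seq s n ≡ t n) →
  (∀ n → t n ℚ.* t n ℚ.≤ seq x n) →
  (∀ n → seq x n ℚ.< (t n ℚ.+ step n) ℚ.* (t n ℚ.+ step n)) → s * s ≈ x
square-of-approximation {s} {x} t s≡t lower upper =
  let (K , 0<K , s≤K) = eventually-bounded s
      -- The error is at most (s + h)² - s² = (2s + h)h with h the grid step; |s| ≤ K and h < 1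
      -- bound the factor by 2K + 1.
      C = K ℚ.+ K ℚ.+ 1ℚ
      0<C = pos-+ (pos-+ 0<K 0<K) (ℚ.positive⁻¹ 1ℚ)
  in null-dominated
    (zip-ev (λ n s≤ h< → close (step n) (ℚ.<⇒≤ (step-pos n))
        (subst (λ t → t ℚ.* t ℚ.≤ seq x n) (sym (s≡t n)) (lower n))
        (subst (λ t → seq x n ℚ.< (t ℚ.+ step n) ℚ.* (t ℚ.+ step n)) (sym (s≡t n)) (upper n))
        s≤ h<)
      s≤K (step-small 1ℚ (ℚ.positive⁻¹ 1ℚ)))
    (null-bounded-* {f = λ _ → C} {g = step} {K = C} 0<C
      (always λ _ → ℚ.≤-reflexive (ℚ.0≤p⇒∣p∣≡p (ℚ.<⇒≤ 0<C))) null-step)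
  where
  close : ∀ {r s K} h → 0ℚ ℚ.≤ h → s ℚ.* s ℚ.≤ r → r ℚ.< (s ℚ.+ h) ℚ.* (s ℚ.+ h) →
          ℚ.∣ s ∣ ℚ.≤ K → h ℚ.< 1ℚ →
          ℚ.∣ s ℚ.* s ℚ.- r ∣ ℚ.≤ ℚ.∣ (K ℚ.+ K ℚ.+ 1ℚ) ℚ.* h ∣
  close {r} {s} {K} h 0≤h s²≤r r< ∣s∣≤K h<1 = begin
    ℚ.∣ s ℚ.* s ℚ.- r ∣               ≡⟨ ∣-∣-swap (s ℚ.* s) r ⟩
    ℚ.∣ r ℚ.- s ℚ.* s ∣               ≡⟨ ℚ.0≤p⇒∣p∣≡p (p≤q⇒0≤q-p s²≤r) ⟩
    r ℚ.- s ℚ.* s                     ≤⟨ ℚ.+-monoˡ-≤ (ℚ.- (s ℚ.* s)) (ℚ.<⇒≤ r<) ⟩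
    (s ℚ.+ h) ℚ.* (s ℚ.+ h) ℚ.- s ℚ.* s
      ≡⟨ solve 2 (λ s h → (s :+ h) :* (s :+ h) :- s :* s := (s :+ s :+ h) :* h) refl s h ⟩
    (s ℚ.+ s ℚ.+ h) ℚ.* h             ≤⟨ *-monoʳ h 0≤h (ℚ.+-mono-≤ (ℚ.+-mono-≤ s≤ s≤) (ℚ.<⇒≤ h<1)) ⟩
    (K ℚ.+ K ℚ.+ 1ℚ) ℚ.* h            ≤⟨ p≤∣p∣ ((K ℚ.+ K ℚ.+ 1ℚ) ℚ.* h) ⟩
    ℚ.∣ (K ℚ.+ K ℚ.+ 1ℚ) ℚ.* h ∣      ∎
    where
    open ℚ.≤-Reasoning
    open +-*-Solver using (solve; _:+_; _:*_; _:-_; _:=_)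
    s≤ : s ℚ.≤ K
    s≤ = ℚ.≤-trans (p≤∣p∣ s) ∣s∣≤K

√-square : ∀ {x} → NonNeg x → √ x * √ x ≈ x
√-square {x} 0≤x = square-of-approximation {√ x} {x} (λ n → approx-√ (seq x n) n) (λ n → refl)
  (λ n → approx-√²≤ n (0≤x n)) (λ n → approx-√-upper (seq x n) n)

-- From s + 1 ≥ 1 follows |s - 1| ≤ |s - 1||s + 1| = |s² - 1|.
square≈1⇒≈1 : ∀ {s} → NonNeg s → s * s ≈ 1ℝ → s ≈ 1ℝ
square≈1⇒≈1 {s} 0≤s = null-dominated (always λ n → close (seq s n) (0≤s n))
  where
  close : ∀ s → 0ℚ ℚ.≤ s → ℚ.∣ s ℚ.- 1ℚ ∣ ℚ.≤ ℚ.∣ s ℚ.* s ℚ.- 1ℚ ∣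
  close s 0≤s = begin
    ℚ.∣ s ℚ.- 1ℚ ∣                        ≡⟨ ℚ.*-identityʳ ℚ.∣ s ℚ.- 1ℚ ∣ ⟨
    ℚ.∣ s ℚ.- 1ℚ ∣ ℚ.* 1ℚ                 ≤⟨ *-monoˡ ℚ.∣ s ℚ.- 1ℚ ∣ (ℚ.0≤∣p∣ (s ℚ.- 1ℚ))
      (ℚ.≤-trans (≤-by-difference {1ℚ} {s ℚ.+ 1ℚ} s 0≤s (ℚ.+-comm 1ℚ s)) (p≤∣p∣ (s ℚ.+ 1ℚ))) ⟩
    ℚ.∣ s ℚ.- 1ℚ ∣ ℚ.* ℚ.∣ s ℚ.+ 1ℚ ∣      ≡⟨ ℚ.∣p*q∣≡∣p∣*∣q∣ (s ℚ.- 1ℚ) (s ℚ.+ 1ℚ) ⟨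
    ℚ.∣ (s ℚ.- 1ℚ) ℚ.* (s ℚ.+ 1ℚ) ∣        ≡⟨ cong ℚ.∣_∣ (solve 1
      (λ s → (s :- con 1ℚ) :* (s :+ con 1ℚ) := s :* s :- con 1ℚ) refl s) ⟩
    ℚ.∣ s ℚ.* s ℚ.- 1ℚ ∣                  ∎
    where
    open ℚ.≤-Reasoning
    open +-*-Solver using (solve; _:+_; _:*_; _:-_; _:=_; con)

√≈1 : ∀ {x} → NonNeg x → x ≈ 1ℝ → √ x ≈ 1ℝ
√≈1 {x} 0≤x x≈1 = square≈1⇒≈1 {√ x} (λ n → approx-√-nonNeg (seq x n) n)
  (≈-trans {√ x * √ x} {x} {1ℝ} (√-square {x} 0≤x) x≈1)

-- Tightness of apartness. Past the Cauchy index for ε/4, a single term of absolute value at least ε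
-- would keep all terms at least ε/4 away from 0. Comparison of rationals is decidable, so the
-- argument is constructive.
¬apart⇒≈0 : ∀ {x} → ¬ (∃ λ ε → 0ℚ ℚ.< ε × Eventually λ n → ε ℚ.≤ ℚ.∣ seq x n ∣) → x ≈ 0ℝ
¬apart⇒≈0 {x} ¬apart = null⇒≈0 {x} λ ε 0<ε →
  let η = half (half ε)
      0<η = half-pos (half-pos 0<ε)
      (N , h) = cauchy x η 0<η
  in N , λ n N≤n → ℚ.≰⇒> λ ε≤ → ¬apart (η , 0<η , N , λ m N≤m → away ε 0<ε
       ε≤ (∣p∣<∣q∣+ε {seq x n} {seq x m} (h n m N≤n N≤m)))
  where
  away : ∀ {p q} ε → 0ℚ ℚ.< ε → ε ℚ.≤ p → p ℚ.< q ℚ.+ half (half ε) → half (half ε) ℚ.≤ q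
  away {p} {q} ε 0<ε ε≤p p<q+η = ℚ.≮⇒≥ λ q<η → ℚ.<-irrefl refl
    (ℚ.<-trans (ℚ.≤-<-trans ε≤p p<q+η)
      (ℚ.<-trans (subst (q ℚ.+ half (half ε) ℚ.<_) (half+half (half ε)) (ℚ.+-monoˡ-< (half (half ε)) q<η))
        (half< 0<ε)))

-- If |x| ≥ ε eventually, then ε|y| ≤ |xy| forces y to 0; hence x is not apart from 0, and tightness
-- makes it 0. A disjunction in the conclusion would require deciding which factor vanishes.
no-zero-divisors : ∀ {x y} → x * y ≈ 0ℝ → ¬ x ≈ 0ℝ → ¬ y ≈ 0ℝ → ⊥
no-zero-divisors {x} {y} xy≈0 x≉0 y≉0 = x≉0 (¬apart⇒≈0 {x} λ (ε , 0<ε , ε≤x) →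
  y≉0 (null⇒≈0 {y} λ η 0<η → zip-ev
    (λ n ε≤ xy< → ℚ.*-cancelˡ-<-nonNeg ε {{ℚ.nonNegative (ℚ.<⇒≤ 0<ε)}}
      (ℚ.≤-<-trans (*-monoʳ ℚ.∣ seq y n ∣ (ℚ.0≤∣p∣ (seq y n)) ε≤)
        (subst (ℚ._< ε ℚ.* η) (ℚ.∣p*q∣≡∣p∣*∣q∣ (seq x n) (seq y n)) xy<)))
    ε≤x (≈0⇒null {x * y} xy≈0 (ε ℚ.* η) (pos-* 0<ε 0<η))))

-- Plane geometry

sqDist : ∀ {d} → Point d → Point d → ℝ
sqDist x y = Vector.foldr _+_ 0ℝ (λ i → (x i - y i) * (x i - y i))

sqDist-nonNeg : ∀ {d} (x y : Point d) → NonNeg (sqDist x y)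
sqDist-nonNeg {zero}  x y n = ℚ.≤-refl
sqDist-nonNeg {suc d} x y n = 0≤+ (0≤p² (seq (x zero) n ℚ.- seq (y zero) n)) (sqDist-nonNeg (x ∘ suc) (y ∘ suc) n)

dist² : ∀ {d} (x y : Point d) → dist x y * dist x y ≈ sqDist x y
dist² x y = √-square {sqDist x y} (sqDist-nonNeg x y)

dist≈⇒sqDist≈ : ∀ {d} (x y : Point d) {δ} → dist x y ≈ δ → sqDist x y ≈ δ * δ
dist≈⇒sqDist≈ x y {δ} h = ≈-trans {sqDist x y} {dist x y * dist x y} {δ * δ}
  (≈-sym {dist x y * dist x y} {sqDist x y} (dist² x y))
  (*-cong {dist x y} {δ} {dist x y} {δ} h h)

coordinate²≤sqDist : ∀ {d} (x y : Point d) i n →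
  (seq (x i) n ℚ.- seq (y i) n) ℚ.* (seq (x i) n ℚ.- seq (y i) n) ℚ.≤ seq (sqDist x y) n
coordinate²≤sqDist {suc d} x y zero n =
  ≤-by-difference _ (sqDist-nonNeg (x ∘ suc) (y ∘ suc) n) refl
coordinate²≤sqDist {suc d} x y (suc i) n =
  ℚ.≤-trans (coordinate²≤sqDist (x ∘ suc) (y ∘ suc) i n)
    (≤-by-difference ((a ℚ.- b) ℚ.* (a ℚ.- b)) (0≤p² (a ℚ.- b))
      (ℚ.+-comm (seq (sqDist (x ∘ suc) (y ∘ suc)) n) ((a ℚ.- b) ℚ.* (a ℚ.- b))))
  where
  a = seq (x zero) n
  b = seq (y zero) n

sqDist≈0⇒≈ᵖ : ∀ {d} (x y : Point d) → sqDist x y ≈ 0ℝ → x ≈ᵖ y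
sqDist≈0⇒≈ᵖ x y h i ε 0<ε = map-ev
  (λ n S<ε² → p²<q²⇒∣p∣<q (ℚ.<⇒≤ 0<ε)
    (ℚ.≤-<-trans (ℚ.≤-trans (coordinate²≤sqDist x y i n) (p≤∣p∣ (seq (sqDist x y) n))) S<ε²))
  (≈0⇒null {sqDist x y} h (ε ℚ.* ε) (pos-* 0<ε 0<ε))

-- Let U, V, W be the squared lengths of vectors u, v, w, and X, Y, Z those of u - v, u - w, v - w.
-- By polarisation the brackets are 2 v·w, 2 u·v and 2 u·w.
gram : (U V W X Y Z : ℝ) → ℝ
gram U V W X Y Z = (U + U) * (V + W - Z) - (U + V - X) * (U + W - Y)

gram-cong : ∀ {U V W X Y Z U′ V′ W′ X′ Y′ Z′} →
  U ≈ U′ → V ≈ V′ → W ≈ W′ → X ≈ X′ → Y ≈ Y′ → Z ≈ Z′ →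
  gram U V W X Y Z ≈ gram U′ V′ W′ X′ Y′ Z′
gram-cong {U} {V} {W} {X} {Y} {Z} {U′} {V′} {W′} {X′} {Y′} {Z′} u v w x y z =
  sub-cong {(U + U) * (V + W - Z)} {(U′ + U′) * (V′ + W′ - Z′)}
           {(U + V - X) * (U + W - Y)} {(U′ + V′ - X′) * (U′ + W′ - Y′)}
    (*-cong {U + U} {U′ + U′} {V + W - Z} {V′ + W′ - Z′}
      (+-cong {U} {U′} {U} {U′} u u)
      (sub-cong {V + W} {V′ + W′} {Z} {Z′} (+-cong {V} {V′} {W} {W′} v w) z))
    (*-cong {U + V - X} {U′ + V′ - X′} {U + W - Y} {U′ + W′ - Y′}
      (sub-cong {U + V} {U′ + V′} {X} {X′} (+-cong {U} {U′} {V} {V′} u v) x)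
      (sub-cong {U + W} {U′ + W′} {Y} {Y′} (+-cong {U} {U′} {W} {W′} u w) y))

-- The planar cross product is doubled so that products of two values are polynomials in squared
-- distances with integer coefficients.
cross₂ : Point 2 → Point 2 → Point 2 → ℝ
cross₂ o b a = α + α
  where α = (b zero - o zero) * (a (suc zero) - o (suc zero))
          - (b (suc zero) - o (suc zero)) * (a zero - o zero)

-- Lagrange's identity (u×v)(u×w) = |u|²(v·w) - (u·v)(u·w), times 4, with the inner
-- products expressed by squared distances.
cross-product : ∀ o b a a′ → cross₂ o b a * cross₂ o b a′ ≈
  gram (sqDist b o) (sqDist a o) (sqDist a′ o) (sqDist b a) (sqDist b a′) (sqDist a a′)
cross-product o b a a′ =
  ≐⇒≈ {cross₂ o b a * cross₂ o b a′}
      {gram (sqDist b o) (sqDist a o) (sqDist a′ o) (sqDist b a) (sqDist b a′) (sqDist a a′)} λ n →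
  solve 8 (λ o₀ o₁ b₀ b₁ a₀ a₁ c₀ c₁ →
    let norm² = λ x y → x :* x :+ (y :* y :+ con 0ℚ)
        α = (b₀ :- o₀) :* (a₁ :- o₁) :- (b₁ :- o₁) :* (a₀ :- o₀)
        β = (b₀ :- o₀) :* (c₁ :- o₁) :- (b₁ :- o₁) :* (c₀ :- o₀)
        U = norm² (b₀ :- o₀) (b₁ :- o₁)
        V = norm² (a₀ :- o₀) (a₁ :- o₁)
        W = norm² (c₀ :- o₀) (c₁ :- o₁)
        X = norm² (b₀ :- a₀) (b₁ :- a₁)
        Y = norm² (b₀ :- c₀) (b₁ :- c₁)
        Z = norm² (a₀ :- c₀) (a₁ :- c₁)
    in (α :+ α) :* (β :+ β) := (U :+ U) :* (V :+ W :- Z) :- (U :+ V :- X) :* (U :+ W :- Y)) refl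
    (seq (o zero) n) (seq (o (suc zero)) n) (seq (b zero) n) (seq (b (suc zero)) n)
    (seq (a zero) n) (seq (a (suc zero)) n) (seq (a′ zero) n) (seq (a′ (suc zero)) n)
  where open +-*-Solver

sqDist-self : ∀ {d} (x : Point d) n → seq (sqDist x x) n ≡ 0ℚ
sqDist-self {zero}  x n = refl
sqDist-self {suc d} x n = cong₂ ℚ._+_
  (solve 1 (λ a → (a :- a) :* (a :- a) := con 0ℚ) refl (seq (x zero) n))
  (sqDist-self (x ∘ suc) n)
  where open +-*-Solver

-- The Cayley-Menger determinant of two triangles with sides √A that share a side
-- and have their other vertices at distance √Z. It vanishes in the plane.
rhombus-relation : ∀ (o b a a′ : Point 2) A → let Z = sqDist a a′ in
  sqDist b o ≈ A → sqDist a o ≈ A → sqDist a′ o ≈ A → sqDist b a ≈ A → sqDist b a′ ≈ A →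
  ((A + A) * (A + A)) * (Z * (A + A + A - Z)) ≈ 0ℝ
rhombus-relation o b a a′ A u v w x y =
  -- In the plane the cross products P and Q are scalars, so P²Q² = (PQ)². With P² = Q² = G₀ = 3A²
  -- and PQ = G = 3A² - 2AZ, the difference G₀² - G² factors as (2A)² Z (3A - Z).
  ≈-trans {((A + A) * (A + A)) * (Z * (A + A + A - Z))} {G₀ * G₀ - G * G} {0ℝ}
    (≐⇒≈ {((A + A) * (A + A)) * (Z * (A + A + A - Z))} {G₀ * G₀ - G * G} λ n →
      solve 2 (λ A Z →
        let g = λ Z → (A :+ A) :* (A :+ A :- Z) :- (A :+ A :- A) :* (A :+ A :- A)
        in ((A :+ A) :* (A :+ A)) :* (Z :* (A :+ A :+ A :- Z))
           := g (con 0ℚ) :* g (con 0ℚ) :- g Z :* g Z)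
        refl (seq A n) (seq Z n))
    (≈-trans {G₀ * G₀ - G * G} {(P * P) * (Q * Q) - (P * Q) * (P * Q)} {0ℝ}
      (sub-cong {G₀ * G₀} {(P * P) * (Q * Q)} {G * G} {(P * Q) * (P * Q)}
        (*-cong {G₀} {P * P} {G₀} {Q * Q} (≈-sym {P * P} {G₀} P²≈) (≈-sym {Q * Q} {G₀} Q²≈))
        (*-cong {G} {P * Q} {G} {P * Q} G≈ G≈))
      (≐⇒≈ {(P * P) * (Q * Q) - (P * Q) * (P * Q)} {0ℝ} λ n →
        solve 2 (λ P Q → (P :* P) :* (Q :* Q) :- (P :* Q) :* (P :* Q) := con 0ℚ)
          refl (seq P n) (seq Q n)))
  where
  open +-*-Solver
  P = cross₂ o b a
  Q = cross₂ o b a′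
  Z = sqDist a a′
  G₀ = gram A A A A A 0ℝ
  G = gram A A A A A Z
  gram≈ : ∀ {c c′ B} → sqDist c o ≈ A → sqDist c′ o ≈ A → sqDist b c ≈ A → sqDist b c′ ≈ A →
          sqDist c c′ ≈ B → cross₂ o b c * cross₂ o b c′ ≈ gram A A A A A B
  gram≈ {c} {c′} {B} v w x y z = ≈-trans {cross₂ o b c * cross₂ o b c′}
    {gram (sqDist b o) (sqDist c o) (sqDist c′ o) (sqDist b c) (sqDist b c′) (sqDist c c′)}
    {gram A A A A A B}
    (cross-product o b c c′)
    (gram-cong {sqDist b o} {sqDist c o} {sqDist c′ o} {sqDist b c} {sqDist b c′} {sqDist c c′}
      {A} {A} {A} {A} {A} {B} u v w x y z)
  self≈0 : ∀ c → sqDist c c ≈ 0ℝ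
  self≈0 c = ≐⇒≈ {sqDist c c} {0ℝ} (sqDist-self c)
  P²≈ : P * P ≈ G₀
  P²≈ = gram≈ {a} {a} {0ℝ} v v x x (self≈0 a)
  Q²≈ : Q * Q ≈ G₀
  Q²≈ = gram≈ {a′} {a′} {0ℝ} w w y y (self≈0 a′)
  G≈ : G ≈ P * Q
  G≈ = ≈-sym {P * Q} {G} (gram≈ {a} {a′} {Z} v w x y (≈-refl {Z}))

-- Without errors, 3δ² = d² ≤ δ². With errors η and η² in the two hypotheses, δ² < (δ + η)² + η² -
-- 2δ² = 4η² - (δ - η)² - η², whence |δ| < 2η.
long-diagonal⇒≈0 : ∀ {d δ} → NonNeg d → d ≤ δ → d * d ≈ δ * δ + δ * δ + δ * δ → δ ≈ 0ℝ
long-diagonal⇒≈0 {d} {δ} 0≤d d≤δ d²≈3δ² = null⇒≈0 {δ} λ ε 0<ε →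
  let η = half ε
      0<η = half-pos 0<ε
  in zip-ev (λ n d≤ h → subst (ℚ.∣ seq δ n ∣ ℚ.<_) (half+half ε)
       (bound (seq d n) (seq δ n) η 0<η (0≤d n) d≤ h))
     (d≤δ η 0<η) (d²≈3δ² (η ℚ.* η) (pos-* 0<η 0<η))
  where
  bound : ∀ d δ η → 0ℚ ℚ.< η → 0ℚ ℚ.≤ d → d ℚ.≤ δ ℚ.+ η →
          ℚ.∣ d ℚ.* d ℚ.- (δ ℚ.* δ ℚ.+ δ ℚ.* δ ℚ.+ δ ℚ.* δ) ∣ ℚ.< η ℚ.* η → ℚ.∣ δ ∣ ℚ.< η ℚ.+ η
  bound d δ η 0<η 0≤d d≤ h = p²<q²⇒∣p∣<q (0≤+ (ℚ.<⇒≤ 0<η) (ℚ.<⇒≤ 0<η)) (begin-strict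
    δ ℚ.* δ
      ≡⟨ solve 1 (λ δ → δ :* δ := δ :* δ :+ δ :* δ :+ δ :* δ :- (δ :* δ :+ δ :* δ)) refl δ ⟩
    δ ℚ.* δ ℚ.+ δ ℚ.* δ ℚ.+ δ ℚ.* δ ℚ.- (δ ℚ.* δ ℚ.+ δ ℚ.* δ)
      <⟨ ℚ.+-monoˡ-< (ℚ.- (δ ℚ.* δ ℚ.+ δ ℚ.* δ)) (∣-∣-one-sided {δ ℚ.* δ ℚ.+ δ ℚ.* δ ℚ.+ δ ℚ.* δ} {d ℚ.* d}
           (subst (ℚ._< η ℚ.* η) (∣-∣-swap (d ℚ.* d) (δ ℚ.* δ ℚ.+ δ ℚ.* δ ℚ.+ δ ℚ.* δ)) h)) ⟩
    d ℚ.* d ℚ.+ η ℚ.* η ℚ.- (δ ℚ.* δ ℚ.+ δ ℚ.* δ)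
      ≤⟨ ℚ.+-monoˡ-≤ (ℚ.- (δ ℚ.* δ ℚ.+ δ ℚ.* δ)) (ℚ.+-monoˡ-≤ (η ℚ.* η) (square-≤ 0≤d d≤)) ⟩
    (δ ℚ.+ η) ℚ.* (δ ℚ.+ η) ℚ.+ η ℚ.* η ℚ.- (δ ℚ.* δ ℚ.+ δ ℚ.* δ)
      ≤⟨ ≤-by-difference ((δ ℚ.- η) ℚ.* (δ ℚ.- η) ℚ.+ η ℚ.* η) (0≤+ (0≤p² (δ ℚ.- η)) (0≤p² η))
           (solve 2 (λ δ η → (δ :+ η) :* (δ :+ η) :+ η :* η :- (δ :* δ :+ δ :* δ)
                             :+ ((δ :- η) :* (δ :- η) :+ η :* η)
                      := (η :+ η) :* (η :+ η)) refl δ η) ⟩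
    (η ℚ.+ η) ℚ.* (η ℚ.+ η) ∎)
    where
    open ℚ.≤-Reasoning
    open +-*-Solver using (solve; _:+_; _:*_; _:-_; _:=_)

-- Each factor in `rhombus-relation` is refuted separately: A = δ² by b ≠ o, Z by a ≠ a′, and 3A - Z
-- because a diagonal of length √3 δ that is at most δ would make δ vanish.
no-unit-rhombus : ∀ (o b a a′ : Point 2) {δ} →
  dist b o ≈ δ → dist a o ≈ δ → dist a′ o ≈ δ → dist b a ≈ δ → dist b a′ ≈ δ →
  dist a a′ ≤ δ → ¬ b ≈ᵖ o → ¬ a ≈ᵖ a′ → ⊥
no-unit-rhombus o b a a′ {δ} bo ao a′o ba ba′ aa′≤δ b≉o a≉a′ =
  no-zero-divisors {A₂ * A₂} {Z * (A + A + A - Z)}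
    (rhombus-relation o b a a′ A (dist≈⇒sqDist≈ b o {δ} bo) (dist≈⇒sqDist≈ a o {δ} ao)
      (dist≈⇒sqDist≈ a′ o {δ} a′o) (dist≈⇒sqDist≈ b a {δ} ba) (dist≈⇒sqDist≈ b a′ {δ} ba′))
    (λ h → no-zero-divisors {A₂} {A₂} h A₂≉0 A₂≉0)
    (λ h → no-zero-divisors {Z} {A + A + A - Z} h
      (a≉a′ ∘ sqDist≈0⇒≈ᵖ a a′) 3A-Z≉0)
  where
  A = δ * δ
  A₂ = A + A
  Z = sqDist a a′
  A≉0 : ¬ A ≈ 0ℝ
  A≉0 h = b≉o (sqDist≈0⇒≈ᵖ b o (≈-trans {sqDist b o} {A} {0ℝ} (dist≈⇒sqDist≈ b o {δ} bo) h))
  A₂≉0 : ¬ A₂ ≈ 0ℝ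
  A₂≉0 h = A≉0 (≈-trans {A} {fromℚ ½ * A₂} {0ℝ}
    (≐⇒≈ {A} {fromℚ ½ * A₂} λ n → solve 1 (λ A → A := con ½ :* (A :+ A)) refl (seq A n))
    (≈-trans {fromℚ ½ * A₂} {fromℚ ½ * 0ℝ} {0ℝ}
      (*-cong {fromℚ ½} {fromℚ ½} {A₂} {0ℝ} (≈-refl {fromℚ ½}) h)
      (≐⇒≈ {fromℚ ½ * 0ℝ} {0ℝ} λ n → refl)))
    where open +-*-Solver
  3A-Z≉0 : ¬ A + A + A - Z ≈ 0ℝ
  3A-Z≉0 h = A≉0 (≈-trans {A} {0ℝ * 0ℝ} {0ℝ}
    (*-cong {δ} {0ℝ} {δ} {0ℝ} δ≈0 δ≈0) (≐⇒≈ {0ℝ * 0ℝ} {0ℝ} λ n → refl))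
    where
    open +-*-Solver
    Z≈3A : Z ≈ A + A + A
    Z≈3A = ≈-sym {A + A + A} {Z} (≈-trans {A + A + A} {A + A + A - Z + Z} {Z}
      (≐⇒≈ {A + A + A} {A + A + A - Z + Z} λ n →
        solve 2 (λ T Z → T := T :- Z :+ Z) refl (seq (A + A + A) n) (seq Z n))
      (≈-trans {A + A + A - Z + Z} {0ℝ + Z} {Z}
        (+-cong {A + A + A - Z} {0ℝ} {Z} {Z} h (≈-refl {Z}))
        (≐⇒≈ {0ℝ + Z} {Z} λ n → ℚ.+-identityˡ (seq Z n))))
    δ≈0 : δ ≈ 0ℝ
    δ≈0 = long-diagonal⇒≈0 {dist a a′} {δ} (λ n → approx-√-nonNeg (seq Z n) n) aa′≤δ
      (≈-trans {dist a a′ * dist a a′} {Z} {A + A + A} (dist² a a′) Z≈3A)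

-- The equilateral triangle

≈⇒≤ : ∀ {x y} → x ≈ y → x ≤ y
≈⇒≤ {x} {y} x≈y ε 0<ε =
  map-ev (λ n h → ℚ.<⇒≤ (∣-∣-one-sided {seq x n} {seq y n} h)) (x≈y ε 0<ε)

¼ ¾ : ℚ
¼ = ½ ℚ.* ½
¾ = ½ ℚ.+ ¼

0<¼ : 0ℚ ℚ.< ¼
0<¼ = ℚ.positive⁻¹ ¼

dist≈1 : ∀ {d} (x y : Point d) → sqDist x y ≈ 1ℝ → dist x y ≈ 1ℝ
dist≈1 x y = √≈1 {sqDist x y} (sqDist-nonNeg x y)

-- Serves the case i = j of `IsDiameter`: an approximation s > 1 would have s² ≥ 1, against s² ≤ 0.
dist-self≤1 : ∀ {d} (x : Point d) → dist x x ≤ 1ℝ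
dist-self≤1 x ε 0<ε = always λ n → ℚ.≤-trans
  (s≤1 (approx-√-nonNeg (seq (sqDist x x) n) n)
    (approx-√²≤ n (sqDist-nonNeg x x n)) (sqDist-self x n))
  (≤-by-difference ε (ℚ.<⇒≤ 0<ε) refl)
  where
  s≤1 : ∀ {s r} → 0ℚ ℚ.≤ s → s ℚ.* s ℚ.≤ r → r ≡ 0ℚ → s ℚ.≤ 1ℚ
  s≤1 {s} 0≤s s²≤r refl = ℚ.≮⇒≥ λ 1<s → ℚ.<-irrefl refl
    (ℚ.<-≤-trans (ℚ.positive⁻¹ 1ℚ) (ℚ.≤-trans (square-≤ (ℚ.nonNegative⁻¹ 1ℚ) (ℚ.<⇒≤ 1<s)) s²≤r))

≉-fromℚ : ∀ {r s} → ¬ ℚ.∣ r ℚ.- s ∣ ℚ.< ¼ → ¬ fromℚ r ≈ fromℚ s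
≉-fromℚ {r} {s} h r≈s = h (fromℚ-close {r} {s} r≈s ¼ 0<¼)

-- The height is a variable of which later only h² = 3/4 is assumed, so no square root is unfolded
-- in the coordinate computations. The abscissae 0, 1, 1/2 already separate the points.
triangle : ℝ → Fin 3 → Point 2
triangle h zero             zero       = 0ℝ
triangle h zero             (suc zero) = 0ℝ
triangle h (suc zero)       zero       = 1ℝ
triangle h (suc zero)       (suc zero) = 0ℝ
triangle h (suc (suc zero)) zero       = fromℚ ½
triangle h (suc (suc zero)) (suc zero) = h

module Equilateral (h : ℝ) (h²≈¾ : h * h ≈ fromℚ ¾) where

  0≉1 : ¬ 0ℝ ≈ 1ℝ
  0≉1 = ≉-fromℚ {0ℚ} {1ℚ} (from-no (ℚ.∣ 0ℚ ℚ.- 1ℚ ∣ ℚ.<? ¼))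

  0≉½ : ¬ 0ℝ ≈ fromℚ ½
  0≉½ = ≉-fromℚ {0ℚ} {½} (from-no (ℚ.∣ 0ℚ ℚ.- ½ ∣ ℚ.<? ¼))

  1≉½ : ¬ 1ℝ ≈ fromℚ ½
  1≉½ = ≉-fromℚ {1ℚ} {½} (from-no (ℚ.∣ 1ℚ ℚ.- ½ ∣ ℚ.<? ¼))

  vertices : PointSet 2 3
  vertices = record { point = triangle h ; distinct = λ {i} {j} → distinct′ i j }
    where
    distinct′ : ∀ i j → triangle h i ≈ᵖ triangle h j → i ≡ j
    distinct′ zero             zero             _ = refl
    distinct′ zero             (suc zero)       e = ⊥-elim (0≉1 (e zero))
    distinct′ zero             (suc (suc zero)) e = ⊥-elim (0≉½ (e zero))
    distinct′ (suc zero)       zero             e = ⊥-elim (0≉1 (≈-sym {1ℝ} {0ℝ} (e zero)))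
    distinct′ (suc zero)       (suc zero)       _ = refl
    distinct′ (suc zero)       (suc (suc zero)) e = ⊥-elim (1≉½ (e zero))
    distinct′ (suc (suc zero)) zero             e = ⊥-elim (0≉½ (≈-sym {fromℚ ½} {0ℝ} (e zero)))
    distinct′ (suc (suc zero)) (suc zero)       e = ⊥-elim (1≉½ (≈-sym {fromℚ ½} {1ℝ} (e zero)))
    distinct′ (suc (suc zero)) (suc (suc zero)) _ = refl

  side : ∀ i j → sqDist (point vertices i) (point vertices j) ≈ fromℚ ¼ + h * h →
         dist (point vertices i) (point vertices j) ≈ 1ℝ
  side i j eq = dist≈1 (point vertices i) (point vertices j)
    (≈-trans {sqDist (point vertices i) (point vertices j)} {fromℚ ¼ + h * h} {1ℝ} eq
      (+-cong {fromℚ ¼} {fromℚ ¼} {h * h} {fromℚ ¾} (≈-refl {fromℚ ¼}) h²≈¾))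

  dist-swap : ∀ i j → dist (point vertices i) (point vertices j) ≈ 1ℝ →
              dist (point vertices j) (point vertices i) ≈ 1ℝ
  dist-swap i j = ≈-respˡ-seq {dist (point vertices i) (point vertices j)} {dist (point vertices j) (point vertices i)}
    {1ℝ} (dist-sym (point vertices i) (point vertices j))

  side₀₁ : dist (point vertices zero) (point vertices (suc zero)) ≈ 1ℝ
  side₀₁ = dist≈1 (point vertices zero) (point vertices (suc zero))
    (≐⇒≈ {sqDist (point vertices zero) (point vertices (suc zero))} {1ℝ} λ n → refl)

  side₀₂ : dist (point vertices zero) (point vertices (suc (suc zero))) ≈ 1ℝ
  side₀₂ = side zero (suc (suc zero))
    (≐⇒≈ {sqDist (point vertices zero) (point vertices (suc (suc zero)))} {fromℚ ¼ + h * h} λ n →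
      solve 1 (λ h → (con 0ℚ :- con ½) :* (con 0ℚ :- con ½) :+ ((con 0ℚ :- h) :* (con 0ℚ :- h) :+ con 0ℚ)
        := con ¼ :+ h :* h) refl (seq h n))
    where open +-*-Solver

  side₁₂ : dist (point vertices (suc zero)) (point vertices (suc (suc zero))) ≈ 1ℝ
  side₁₂ = side (suc zero) (suc (suc zero))
    (≐⇒≈ {sqDist (point vertices (suc zero)) (point vertices (suc (suc zero)))} {fromℚ ¼ + h * h} λ n →
      solve 1 (λ h → (con 1ℚ :- con ½) :* (con 1ℚ :- con ½) :+ ((con 0ℚ :- h) :* (con 0ℚ :- h) :+ con 0ℚ)
        := con ¼ :+ h :* h) refl (seq h n))
    where open +-*-Solver

  sides : ∀ i j → i ≢ j → dist (point vertices i) (point vertices j) ≈ 1ℝ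
  sides zero             zero             i≢j = ⊥-elim (i≢j refl)
  sides zero             (suc zero)       _   = side₀₁
  sides zero             (suc (suc zero)) _   = side₀₂
  sides (suc zero)       zero             _   = dist-swap zero (suc zero) side₀₁
  sides (suc zero)       (suc zero)       i≢j = ⊥-elim (i≢j refl)
  sides (suc zero)       (suc (suc zero)) _   = side₁₂
  sides (suc (suc zero)) zero             _   = dist-swap zero (suc (suc zero)) side₀₂
  sides (suc (suc zero)) (suc zero)       _   = dist-swap (suc zero) (suc (suc zero)) side₁₂
  sides (suc (suc zero)) (suc (suc zero)) i≢j = ⊥-elim (i≢j refl)

height : ℝ
height = √ (fromℚ ¾)

height² : height * height ≈ fromℚ ¾
height² = √-square {fromℚ ¾} (λ _ → ℚ.nonNegative⁻¹ ¾)

unit-triangle : ∃ λ (V : PointSet 2 3) →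
  ∀ i j → i ≢ j → dist (point V i) (point V j) ≈ 1ℝ
unit-triangle = vertices , sides
  where open Equilateral height height²

simplex-diameter : ∀ {d m} (V : PointSet d (suc (suc m))) →
  (∀ i j → i ≢ j → dist (point V i) (point V j) ≈ 1ℝ) → IsDiameter V 1ℝ
simplex-diameter V apart =
  (zero , suc zero , apart zero (suc zero) λ ()) , λ i j → below i j (i Fin.≟ j)
  where
  below : ∀ i j → Dec (i ≡ j) → dist (point V i) (point V j) ≤ 1ℝ
  below i j (yes refl) = dist-self≤1 (point V i)
  below i j (no i≢j)   = ≈⇒≤ {dist (point V i) (point V j)} {1ℝ} (apart i j i≢j)

-- Triangles in diameter graphs

IsComplete : Graph → Set
IsComplete G = ∀ {u v} → u ≢ v → u ~ v
  where open Graph G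

module _ (G : Graph) (f : Graph.Vertex G ↔ Fin 3) (complete : IsComplete G) where
  open Graph G
  private
    to = Inverse.to f
    to-injective : ∀ {u v} → to u ≡ to v → u ≡ v
    to-injective = Injection.injective (↔⇒↣ f)

    ~⇒≢ : ∀ {u v} → u ~ v → u ≢ v
    ~⇒≢ u~v refl = ~-irrefl u~v

  K₃-isDiameterGraph : IsDiameterGraph 2 G
  -- The point set enters as a variable, so its coordinates stay opaque while the isomorphism is
  -- checked.
  K₃-isDiameterGraph = isDiameterGraph unit-triangle
    where
    isDiameterGraph : (∃ λ (V : PointSet 2 3) →
      ∀ i j → i ≢ j → dist (point V i) (point V j) ≈ 1ℝ) → IsDiameterGraph 2 G
    isDiameterGraph (V , apart) = 3 , V , 1ℝ , simplex-diameter V apart , record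
      { bijection = f
      ; adjacency = λ u v → mk⇔
          (λ u~v → ~⇒≢ u~v ∘ to-injective ,
            apart (Inverse.to f u) (Inverse.to f v) (~⇒≢ u~v ∘ to-injective))
          (λ (fu≢fv , _) → complete (fu≢fv ∘ cong to))
      }

  -- A proper colouring of a complete graph is injective, so c colours yield an injection from
  -- `Fin 3` to `Fin c`.
  K₃-hasChromaticNumber : HasChromaticNumber G 3
  K₃-hasChromaticNumber = (to , λ u v u~v → ~⇒≢ u~v ∘ to-injective) , λ c (g , proper) →
    Fin.injective⇒≤ {f = g ∘ Inverse.from f} λ {i} {j} eq →
      from-injective (g-injective proper eq)
    where
    from-injective : ∀ {i j} → Inverse.from f i ≡ Inverse.from f j → i ≡ j
    from-injective {i} {j} eq = trans (sym (Inverse.strictlyInverseˡ f i))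
      (trans (cong to eq) (Inverse.strictlyInverseˡ f j))
    g-injective : ∀ {c} {g : Vertex → Fin c} → (∀ u v → u ~ v → g u ≢ g v) →
                  ∀ {u v} → g u ≡ g v → u ≡ v
    g-injective proper {u} {v} eq with to u Fin.≟ to v
    ... | yes e = to-injective e
    ... | no ne = ⊥-elim (proper u v (complete (ne ∘ cong to)) eq)

  K₃-connected : Connected G
  K₃-connected u v with to u Fin.≟ to v
  ... | yes e = subst (Star.Star _~_ u) (to-injective e) Star.ε
  ... | no ne = complete (ne ∘ cong to) Star.◅ Star.ε

-- The distance of a and a′ would be √3 times the diameter.
diameterGraph-no-K₄⁻ : ∀ {G} → let open Graph G in IsDiameterGraph 2 G → ∀ {o b a a′} →
  b ~ o → a ~ o → a′ ~ o → b ~ a → b ~ a′ → a ≢ a′ → ⊥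
diameterGraph-no-K₄⁻ {G} (m , V , δ , (_ , ≤δ) , iso) {o} {b} {a} {a′} bo ao a′o ba ba′ a≢a′ =
  no-unit-rhombus
    (point V (Inverse.to (_≅_.bijection iso) o)) (point V (Inverse.to (_≅_.bijection iso) b))
    (point V (Inverse.to (_≅_.bijection iso) a)) (point V (Inverse.to (_≅_.bijection iso) a′)) {δ}
    (edge bo) (edge ao) (edge a′o) (edge ba) (edge ba′)
    (≤δ (Inverse.to (_≅_.bijection iso) a) (Inverse.to (_≅_.bijection iso) a′))
    (apart λ eq → ~-irrefl (subst (_~ o) eq bo)) (apart a≢a′)
  where
  open Graph G
  edge : ∀ {u v} → u ~ v →
    dist (point V (Inverse.to (_≅_.bijection iso) u)) (point V (Inverse.to (_≅_.bijection iso) v)) ≈ δ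
  edge {u} {v} u~v = proj₂ (Equivalence.to (_≅_.adjacency iso u v) u~v)
  apart : ∀ {u v} → u ≢ v →
    ¬ point V (Inverse.to (_≅_.bijection iso) u) ≈ᵖ point V (Inverse.to (_≅_.bijection iso) v)
  apart u≢v eq = u≢v (Injection.injective (↔⇒↣ (_≅_.bijection iso)) (distinct V eq))

-- Graphs whose complement is a matching

Vertices : ∀ {n} → Subset n → Set
Vertices W = ∃ λ v → v ∈ W

-- Membership proofs in a subset are unique.
vertex-≡ : ∀ {n} {W : Subset n} {u v : Vertices W} → proj₁ u ≡ proj₁ v → u ≡ v
vertex-≡ {u = _ , p} {v = _ , q} refl = cong (_ ,_) (Vec.[]=-irrelevant p q)

enumerate : ∀ {n} (W : Subset n) → Vertices W ↔ Fin (card W)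
enumerate W = mk↔ₛ′ (to W) (from W) (to-from W) (from-to W)
  where
  to : ∀ {n} (W : Subset n) → Vertices W → Fin (card W)
  to (inside  ∷ W) (zero  , here)    = zero
  to (inside  ∷ W) (suc v , there p) = suc (to W (v , p))
  to (outside ∷ W) (suc v , there p) = to W (v , p)

  weaken : ∀ {n b} {W : Subset n} → Vertices W → Vertices (b ∷ W)
  weaken (v , p) = suc v , there p

  from : ∀ {n} (W : Subset n) → Fin (card W) → Vertices W
  from (inside  ∷ W) zero    = zero , here
  from (inside  ∷ W) (suc i) = weaken (from W i)
  from (outside ∷ W) i       = weaken (from W i)

  to-from : ∀ {n} (W : Subset n) i → to W (from W i) ≡ i
  to-from (inside  ∷ W) zero    = refl
  to-from (inside  ∷ W) (suc i) = cong suc (to-from W i)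
  to-from (outside ∷ W) i       = to-from W i

  from-to : ∀ {n} (W : Subset n) v → from W (to W v) ≡ v
  from-to (inside  ∷ W) (zero  , here)    = refl
  from-to (inside  ∷ W) (suc v , there p) = cong weaken (from-to W (v , p))
  from-to (outside ∷ W) (suc v , there p) = cong weaken (from-to W (v , p))

insert : ∀ {n} → Fin n → Subset n → Subset n
insert v W = W [ v ]≔ inside

∈-insert⁻ : ∀ {n} {u} v (W : Subset n) → u ∈ insert v W → u ≡ v ⊎ u ∈ W
∈-insert⁻ zero    (_ ∷ W) here      = inj₁ refl
∈-insert⁻ zero    (_ ∷ W) (there p) = inj₂ (there p)
∈-insert⁻ (suc v) (_ ∷ W) here      = inj₂ here
∈-insert⁻ (suc v) (_ ∷ W) (there p) = Sum.map (cong suc) there (∈-insert⁻ v W p)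

card-insert : ∀ {n} v (W : Subset n) → ¬ v ∈ W → card (insert v W) ≡ suc (card W)
card-insert zero    (inside  ∷ W) v∉W = ⊥-elim (v∉W here)
card-insert zero    (outside ∷ W) v∉W = refl
card-insert (suc v) (inside  ∷ W) v∉W = cong suc (card-insert v W (v∉W ∘ there))
card-insert (suc v) (outside ∷ W) v∉W = card-insert v W (v∉W ∘ there)

-- Pigeonhole: were every value attained, a choice of preimages would inject `Fin k` into `Fin m`.
fresh : ∀ {m k} → m ℕ.< k → (g : Fin m → Fin k) → ∃ λ i → ∀ j → g j ≢ i
fresh {m} {k} m<k g =
  let (i , ¬hit) = Fin.¬∀⟶∃¬ k (λ i → ∃ λ j → g j ≡ i) (λ i → Fin.any? λ j → g j Fin.≟ i)
        λ hit → ℕ.<⇒≱ m<k (Fin.injective⇒≤ {f = proj₁ ∘ hit} λ {i} {i′} eq →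
          trans (sym (proj₂ (hit i))) (trans (cong g eq) (proj₂ (hit i′))))
  in i , λ j eq → ¬hit (j , eq)

Adjacent? : ∀ {n} (G : LabelledGraph n) i j → Dec (Adjacent G i j)
Adjacent? (N ▹ G) zero    zero    = no λ ()
Adjacent? (N ▹ G) zero    (suc j) = j Subset.∈? N
Adjacent? (N ▹ G) (suc i) zero    = i Subset.∈? N
Adjacent? (N ▹ G) (suc i) (suc j) = Adjacent? G i j

-- No two non-edges share a vertex. The disjunction is the form that hands over an edge directly.
CoMatching : ∀ {n} → LabelledGraph n → Set
CoMatching G = ∀ {u v w} → u ≢ v → u ≢ w → v ≢ w → Adjacent G u v ⊎ Adjacent G u w

Triangle : ∀ {n} → LabelledGraph n → Set
Triangle G = ∃ λ u → ∃ λ v → ∃ λ w → Adjacent G u v × Adjacent G u w × Adjacent G v w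

module _ {n} (G : LabelledGraph n) (matching : CoMatching G) where

  triangle-at : ∀ {x a b c} → Adjacent G x a → Adjacent G x b → Adjacent G x c →
                a ≢ b → a ≢ c → b ≢ c → Triangle G
  triangle-at xa xb xc a≢b a≢c b≢c with matching a≢b a≢c b≢c
  ... | inj₁ ab = _ , _ , _ , xa , xb , ab
  ... | inj₂ ac = _ , _ , _ , xa , xc , ac

  -- At most one of a, b, c, d is not adjacent to x, which leaves three neighbours.
  triangle-among : ∀ {x a b c d} → x ≢ a → x ≢ b → x ≢ c → x ≢ d →
    a ≢ b → a ≢ c → a ≢ d → b ≢ c → b ≢ d → c ≢ d → Triangle G
  triangle-among xa xb xc xd ab ac ad bc bd cd with matching xa xb ab | matching xc xd cd
  ... | inj₁ x~a | inj₁ x~c = Sum.[ (λ x~b → triangle-at x~a x~c x~b ac ab (bc ∘ sym))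
                                  , (λ x~d → triangle-at x~a x~c x~d ac ad cd) ] (matching xb xd bd)
  ... | inj₁ x~a | inj₂ x~d = Sum.[ (λ x~b → triangle-at x~a x~d x~b ad ab (bd ∘ sym))
                                  , (λ x~c → triangle-at x~a x~d x~c ad ac (cd ∘ sym)) ] (matching xb xc bc)
  ... | inj₂ x~b | inj₁ x~c = Sum.[ (λ x~a → triangle-at x~b x~c x~a bc (ab ∘ sym) (ac ∘ sym))
                                  , (λ x~d → triangle-at x~b x~c x~d bc bd cd) ] (matching xa xd ad)
  ... | inj₂ x~b | inj₂ x~d = Sum.[ (λ x~a → triangle-at x~b x~d x~a bd (ab ∘ sym) (ad ∘ sym))
                                  , (λ x~c → triangle-at x~b x~d x~c bd bc (cd ∘ sym)) ] (matching xa xc ac)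

-- The bound 5 is sharp: on four vertices the complement of a perfect matching is a 4-cycle.
coMatching⇒triangle : ∀ {n} (G : LabelledGraph n) → 5 ℕ.≤ n → CoMatching G → Triangle G
coMatching⇒triangle G (ℕ.s≤s (ℕ.s≤s (ℕ.s≤s (ℕ.s≤s (ℕ.s≤s _))))) matching =
  triangle-among G matching {zero} {suc zero} {suc (suc zero)} {suc (suc (suc zero))}
    {suc (suc (suc (suc zero)))}
    (λ ()) (λ ()) (λ ()) (λ ()) (λ ()) (λ ()) (λ ()) (λ ()) (λ ()) (λ ())

triangle⇒K₃ : ∀ {n} (G : LabelledGraph n) → Triangle G → ∃ λ W → card W ≡ 3 × IsComplete (G [ W ])
triangle⇒K₃ {n} G (u , v , w , uv , uw , vw) = W , card-W , complete
  where
  W₁ = insert w Subset.⊥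
  W₂ = insert v W₁
  W  = insert u W₂

  ∈W₁ : ∀ {x} → x ∈ W₁ → x ≡ w
  ∈W₁ x∈ = Sum.[ (λ eq → eq) , ⊥-elim ∘ Subset.∉⊥ ] (∈-insert⁻ w Subset.⊥ x∈)

  ∈W₂ : ∀ {x} → x ∈ W₂ → x ≡ v ⊎ x ≡ w
  ∈W₂ x∈ = Sum.map₂ ∈W₁ (∈-insert⁻ v W₁ x∈)

  ∈W : ∀ {x} → x ∈ W → x ≡ u ⊎ x ≡ v ⊎ x ≡ w
  ∈W x∈ = Sum.map₂ ∈W₂ (∈-insert⁻ u W₂ x∈)

  ~⇒≢ : ∀ {x y} → Adjacent G x y → x ≢ y
  ~⇒≢ xy refl = Adjacent-irrefl G _ xy

  card-W : card W ≡ 3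
  card-W = trans (card-insert u W₂ (Sum.[ ~⇒≢ uv , ~⇒≢ uw ] ∘ ∈W₂)) (cong suc
    (trans (card-insert v W₁ (~⇒≢ vw ∘ ∈W₁)) (cong suc
      (trans (card-insert w Subset.⊥ Subset.∉⊥) (cong suc (Subset.∣⊥∣≡0 n))))))

  complete : IsComplete (G [ W ])
  complete {x , x∈W} {y , y∈W} x≢y = adjacent (∈W x∈W) (∈W y∈W) (x≢y ∘ vertex-≡)
    where
    adjacent : ∀ {x y} → x ≡ u ⊎ x ≡ v ⊎ x ≡ w → y ≡ u ⊎ y ≡ v ⊎ y ≡ w → x ≢ y → Adjacent G x y
    adjacent (inj₁ refl)        (inj₁ refl)        ne = ⊥-elim (ne refl)
    adjacent (inj₁ refl)        (inj₂ (inj₁ refl)) ne = uv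
    adjacent (inj₁ refl)        (inj₂ (inj₂ refl)) ne = uw
    adjacent (inj₂ (inj₁ refl)) (inj₁ refl)        ne = Adjacent-sym G u v uv
    adjacent (inj₂ (inj₁ refl)) (inj₂ (inj₁ refl)) ne = ⊥-elim (ne refl)
    adjacent (inj₂ (inj₁ refl)) (inj₂ (inj₂ refl)) ne = vw
    adjacent (inj₂ (inj₂ refl)) (inj₁ refl)        ne = Adjacent-sym G u w uw
    adjacent (inj₂ (inj₂ refl)) (inj₂ (inj₁ refl)) ne = Adjacent-sym G v w vw
    adjacent (inj₂ (inj₂ refl)) (inj₂ (inj₂ refl)) ne = ⊥-elim (ne refl)

coMatching⇒hasDiameterSubgraph : ∀ {n} (G : LabelledGraph n) → 5 ℕ.≤ n → CoMatching G →
  HasDiameterSubgraph 2 3 G × HasDiameterSubgraph′ 2 3 G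
coMatching⇒hasDiameterSubgraph G 5≤n matching =
  let (W , card≡3 , complete) = triangle⇒K₃ G (coMatching⇒triangle G 5≤n matching)
      f = subst (λ k → Vertices W ↔ Fin k) card≡3 (enumerate W)
      diam = K₃-isDiameterGraph (G [ W ]) f complete
      χ≡3 = K₃-hasChromaticNumber (G [ W ]) f complete
  in (W , card≡3 , diam , χ≡3) , (W , card≡3 , diam , χ≡3 , K₃-connected (G [ W ]) f complete)

module _ {n} (G : LabelledGraph n) (matching : CoMatching G) (W : Subset n)
         (4≤card : 4 ℕ.≤ card W) (diam : IsDiameterGraph 2 (G [ W ])) where
  open Graph (G [ W ])

  private
    flip~ : ∀ {u v} → u ~ v → v ~ u
    flip~ {u} {v} = ~-sym {u} {v}

    ~⇒≢ : ∀ {u v} → u ~ v → u ≢ v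
    ~⇒≢ {u} uv refl = ~-irrefl {u} uv

    match : ∀ {u v w : Vertex} → u ≢ v → u ≢ w → v ≢ w → u ~ v ⊎ u ~ w
    match u≢v u≢w v≢w = matching (u≢v ∘ vertex-≡) (u≢w ∘ vertex-≡) (v≢w ∘ vertex-≡)

    other-vertex : ∀ u v w → ∃ λ t → t ≢ u × t ≢ v × t ≢ w
    other-vertex u v w =
      let open Inverse (enumerate W)
          (i , ≢i) = fresh 4≤card (to ∘ Vector.fromVec (u ∷ v ∷ w ∷ []))
          differs : ∀ j → from i ≢ Vec.lookup (u ∷ v ∷ w ∷ []) j
          differs j eq = ≢i j (trans (cong to (sym eq)) (strictlyInverseˡ i))
      in from i , differs zero , differs (suc zero) , differs (suc (suc zero))

    no-shared-edge : ∀ {u v w t} → u ~ v → u ~ w → v ~ w → t ~ u → t ~ v → t ≢ w → ⊥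
    no-shared-edge {u} {v} {w} {t} uv uw vw tu tv t≢w =
      diameterGraph-no-K₄⁻ {G [ W ]} diam {u} {v} {w} {t}
        (flip~ {u} {v} uv) (flip~ {u} {w} uw) tu vw (flip~ {t} {v} tv) (t≢w ∘ sym)

  triangle-free : ∀ {u v w} → u ~ v → u ~ w → v ~ w → ⊥
  triangle-free {u} {v} {w} uv uw vw =
    let (t , t≢u , t≢v , t≢w) = other-vertex u v w
    in Sum.[ (λ tu → Sum.[ (λ tv → no-shared-edge {u} {v} {w} {t} uv uw vw tu tv t≢w)
                         , (λ tw → no-shared-edge {u} {w} {v} {t} uw uv (flip~ {v} {w} vw) tu tw t≢v)
                         ] (match t≢v t≢w (~⇒≢ vw)))
           , (λ tv → Sum.[ (λ tu → no-shared-edge {u} {v} {w} {t} uv uw vw tu tv t≢w)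
                         , (λ tw → no-shared-edge {v} {w} {u} {t} vw (flip~ {u} {v} uv) (flip~ {u} {w} uw) tv tw t≢u)
                         ] (match t≢u t≢w (~⇒≢ {u} {w} uw)))
           ] (match t≢u t≢v (~⇒≢ uv))

  two-colourable : Colourable (G [ W ]) 2
  two-colourable = colour , proper
    where
    x : Vertex
    x = Inverse.from (enumerate W) (Fin.fromℕ< (ℕ.≤-trans (ℕ.s≤s ℕ.z≤n) 4≤card))

    colour′ : ∀ {P : Set} → Dec P → Fin 2
    colour′ (yes _) = suc zero
    colour′ (no _)  = zero

    colour : Vertex → Fin 2
    colour u = colour′ (Adjacent? G (proj₁ x) (proj₁ u))

    differ : ∀ u v → u ~ v → (d : Dec (x ~ u)) (e : Dec (x ~ v)) → colour′ d ≢ colour′ e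
    differ u v uv (yes xu) (yes xv) _ = triangle-free {x} {u} {v} xu xv uv
    -- If x is neither u nor v, it cannot miss both. If it is one of them, the edge between u and v
    -- makes the other a neighbour of x.
    differ u v uv (no ¬xu) (no ¬xv) _ = Sum.[ ¬xu , ¬xv ]
      (match {x} {u} {v} (λ { refl → ¬xv uv }) (λ { refl → ¬xu (flip~ {u} {x} uv) }) (~⇒≢ {u} {v} uv))

    proper : ∀ u v → u ~ v → colour u ≢ colour v
    proper u v uv = differ u v uv (Adjacent? G (proj₁ x) (proj₁ u)) (Adjacent? G (proj₁ x) (proj₁ v))

coMatching⇒≤3 : ∀ {n} (G : LabelledGraph n) → CoMatching G → ∀ {j} → HasDiameterSubgraph 2 j G → j ℕ.≤ 3
coMatching⇒≤3 G matching {j} (W , refl , diam , _ , χ-min) = ℕ.≮⇒≥ λ 4≤j →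
  ℕ.<-irrefl refl (χ-min 2 (two-colourable G matching W 4≤j diam))

-- Counting pairs of non-edges with a common vertex

missing : ∀ {n} → Subset n → (Fin n → ℕ) → ℕ
missing []            g = 0
missing (inside  ∷ N) g = missing N (g ∘ suc)
missing (outside ∷ N) g = g zero ℕ.+ missing N (g ∘ suc)

-- For k elements outside the subset this is k(k - 1)/2, in a recursive form along which its
-- expectation can be computed.
missingPairs : ∀ {n} → Subset n → ℕ
missingPairs []            = 0
missingPairs (inside  ∷ N) = missingPairs N
missingPairs (outside ∷ N) = missing N (λ _ → 1) ℕ.+ missingPairs N

nonNeighbours : ∀ {n} → LabelledGraph n → Fin n → ℕ
nonNeighbours (N ▹ G) zero    = missing N (λ _ → 1)
nonNeighbours (N ▹ G) (suc v) = (if Vec.lookup N v then 0 else 1) ℕ.+ nonNeighbours G v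

-- The number of pairs of non-edges with a common vertex.
cherries : ∀ {n} → LabelledGraph n → ℕ
cherries ∅       = 0
-- The new vertex is either the common vertex of a new pair, or the end of one non-edge whose other
-- end v carries a second non-edge inside G.
cherries (N ▹ G) = cherries G ℕ.+ (missingPairs N ℕ.+ missing N (nonNeighbours G))

missing≡0 : ∀ {n} (N : Subset n) g → missing N g ≡ 0 → ∀ v → v ∈ N ⊎ g v ≡ 0
missing≡0 (inside  ∷ N) g eq zero    = inj₁ here
missing≡0 (outside ∷ N) g eq zero    = inj₂ (ℕ.m+n≡0⇒m≡0 (g zero) eq)
missing≡0 (inside  ∷ N) g eq (suc v) = Sum.map₁ there (missing≡0 N (g ∘ suc) eq v)
missing≡0 (outside ∷ N) g eq (suc v) =
  Sum.map₁ there (missing≡0 N (g ∘ suc) (ℕ.m+n≡0⇒n≡0 (g zero) eq) v)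

none-missing : ∀ {n} (N : Subset n) → missing N (λ _ → 1) ≡ 0 → ∀ v → v ∈ N
none-missing N eq v = Sum.[ (λ v∈N → v∈N) , (λ ()) ] (missing≡0 N (λ _ → 1) eq v)

missingPairs≡0 : ∀ {n} (N : Subset n) → missingPairs N ≡ 0 → ∀ {v w} → v ≢ w → v ∈ N ⊎ w ∈ N
missingPairs≡0 (_       ∷ N) eq {zero}  {zero}  v≢w = ⊥-elim (v≢w refl)
missingPairs≡0 (inside  ∷ N) eq {zero}  {suc w} v≢w = inj₁ here
missingPairs≡0 (outside ∷ N) eq {zero}  {suc w} v≢w =
  inj₂ (there (none-missing N (ℕ.m+n≡0⇒m≡0 _ eq) w))
missingPairs≡0 (inside  ∷ N) eq {suc v} {zero}  v≢w = inj₂ here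
missingPairs≡0 (outside ∷ N) eq {suc v} {zero}  v≢w =
  inj₁ (there (none-missing N (ℕ.m+n≡0⇒m≡0 _ eq) v))
missingPairs≡0 (inside  ∷ N) eq {suc v} {suc w} v≢w =
  Sum.map there there (missingPairs≡0 N eq (v≢w ∘ cong suc))
missingPairs≡0 (outside ∷ N) eq {suc v} {suc w} v≢w =
  Sum.map there there (missingPairs≡0 N (ℕ.m+n≡0⇒n≡0 (missing N (λ _ → 1)) eq) (v≢w ∘ cong suc))

nonNeighbours≡0 : ∀ {n} (G : LabelledGraph n) v → nonNeighbours G v ≡ 0 → ∀ {w} → v ≢ w → Adjacent G v w
nonNeighbours≡0 (N ▹ G) zero    eq {zero}  v≢w = ⊥-elim (v≢w refl)
nonNeighbours≡0 (N ▹ G) zero    eq {suc w} v≢w = none-missing N eq w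
nonNeighbours≡0 (N ▹ G) (suc v) eq {suc w} v≢w =
  nonNeighbours≡0 G v (ℕ.m+n≡0⇒n≡0 (if Vec.lookup N v then 0 else 1) eq) (v≢w ∘ cong suc)
nonNeighbours≡0 (N ▹ G) (suc v) eq {zero}  v≢w = Vec.lookup⇒[]= v N
  (present (Vec.lookup N v) (ℕ.m+n≡0⇒m≡0 (if Vec.lookup N v then 0 else 1) eq))
  where
  present : ∀ b → (if b then 0 else 1) ≡ 0 → b ≡ inside
  present true _ = refl

cherries≡0⇒coMatching : ∀ {n} (G : LabelledGraph n) → cherries G ≡ 0 → CoMatching G
cherries≡0⇒coMatching (N ▹ G) eq = coMatching _ _ _
  where
  cherries≡0 = ℕ.m+n≡0⇒m≡0 (cherries G) eq
  new≡0 = ℕ.m+n≡0⇒n≡0 (cherries G) eq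
  pairs≡0 = ℕ.m+n≡0⇒m≡0 (missingPairs N) new≡0

  joined : ∀ u {w} → u ≢ w → u ∈ N ⊎ Adjacent G u w
  joined u u≢w = Sum.map₂ (λ e → nonNeighbours≡0 G u e u≢w)
    (missing≡0 N (nonNeighbours G) (ℕ.m+n≡0⇒n≡0 (missingPairs N) new≡0) u)

  coMatching : ∀ u v w → u ≢ v → u ≢ w → v ≢ w → Adjacent (N ▹ G) u v ⊎ Adjacent (N ▹ G) u w
  coMatching zero    zero    w       uv uw vw = ⊥-elim (uv refl)
  coMatching zero    (suc v) zero    uv uw vw = ⊥-elim (uw refl)
  coMatching zero    (suc v) (suc w) uv uw vw = missingPairs≡0 N pairs≡0 (vw ∘ cong suc)
  coMatching (suc u) zero    zero    uv uw vw = ⊥-elim (vw refl)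
  coMatching (suc u) zero    (suc w) uv uw vw = joined u (uw ∘ cong suc)
  coMatching (suc u) (suc v) zero    uv uw vw = Sum.swap (joined u (uv ∘ cong suc))
  coMatching (suc u) (suc v) (suc w) uv uw vw =
    cherries≡0⇒coMatching G cherries≡0 (uv ∘ cong suc) (uw ∘ cong suc) (vw ∘ cong suc)

-- Expectations in the random graph

weightedSum : {A : Set} → (A → ℚ) → List A → (A → ℚ) → ℚ
weightedSum w []       f = 0ℚ
weightedSum w (x ∷ xs) f = w x ℚ.* f x ℚ.+ weightedSum w xs f

module _ {A : Set} where

  weightedSum-cong : ∀ {w w′ f g : A → ℚ} xs → (∀ x → w x ≡ w′ x) → (∀ x → f x ≡ g x) →
                     weightedSum w xs f ≡ weightedSum w′ xs g
  weightedSum-cong []       w≡ f≡ = refl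
  weightedSum-cong (x ∷ xs) w≡ f≡ =
    cong₂ ℚ._+_ (cong₂ ℚ._*_ (w≡ x) (f≡ x)) (weightedSum-cong xs w≡ f≡)

  weightedSum-+ : ∀ (w : A → ℚ) xs {f g : A → ℚ} →
    weightedSum w xs (λ x → f x ℚ.+ g x) ≡ weightedSum w xs f ℚ.+ weightedSum w xs g
  weightedSum-+ w []       = refl
  weightedSum-+ w (x ∷ xs) {f} {g} = trans
    (cong (w x ℚ.* (f x ℚ.+ g x) ℚ.+_) (weightedSum-+ w xs {f} {g}))
    (solve 5 (λ w a b s t → w :* (a :+ b) :+ (s :+ t) := (w :* a :+ s) :+ (w :* b :+ t)) refl
      (w x) (f x) (g x) (weightedSum w xs f) (weightedSum w xs g))
    where open +-*-Solver

  weightedSum-* : ∀ (w : A → ℚ) xs c {f : A → ℚ} →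
    weightedSum w xs (λ x → c ℚ.* f x) ≡ c ℚ.* weightedSum w xs f
  weightedSum-* w []       c = sym (ℚ.*-zeroʳ c)
  weightedSum-* w (x ∷ xs) c {f} = trans
    (cong (w x ℚ.* (c ℚ.* f x) ℚ.+_) (weightedSum-* w xs c {f}))
    (solve 4 (λ w c a s → w :* (c :* a) :+ c :* s := c :* (w :* a :+ s)) refl
      (w x) c (f x) (weightedSum w xs f))
    where open +-*-Solver

  weightedSum-mono : ∀ {w f g : A → ℚ} xs → (∀ x → 0ℚ ℚ.≤ w x) → (∀ x → f x ℚ.≤ g x) →
                     weightedSum w xs f ℚ.≤ weightedSum w xs g
  weightedSum-mono         []       0≤w f≤g = ℚ.≤-refl
  weightedSum-mono {w} {f} (x ∷ xs) 0≤w f≤g =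
    ℚ.+-mono-≤ (*-monoˡ (w x) (0≤w x) (f≤g x)) (weightedSum-mono xs 0≤w f≤g)

  weightedSum-++ : ∀ (w : A → ℚ) xs ys f →
    weightedSum w (xs List.++ ys) f ≡ weightedSum w xs f ℚ.+ weightedSum w ys f
  weightedSum-++ w []       ys f = sym (ℚ.+-identityˡ (weightedSum w ys f))
  weightedSum-++ w (x ∷ xs) ys f = trans (cong (w x ℚ.* f x ℚ.+_) (weightedSum-++ w xs ys f))
    (sym (ℚ.+-assoc (w x ℚ.* f x) (weightedSum w xs f) (weightedSum w ys f)))

weightedSum-map : ∀ {A B : Set} (w : B → ℚ) (h : A → B) xs f →
  weightedSum w (List.map h xs) f ≡ weightedSum (w ∘ h) xs (f ∘ h)
weightedSum-map w h []       f = refl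
weightedSum-map w h (x ∷ xs) f = cong (w (h x) ℚ.* f (h x) ℚ.+_) (weightedSum-map w h xs f)

weightedSum-scale : ∀ {A : Set} (w : A → ℚ) xs c {f : A → ℚ} →
  weightedSum (λ x → c ℚ.* w x) xs f ≡ c ℚ.* weightedSum w xs f
weightedSum-scale w []       c = sym (ℚ.*-zeroʳ c)
weightedSum-scale w (x ∷ xs) c {f} = trans
  (cong (c ℚ.* w x ℚ.* f x ℚ.+_) (weightedSum-scale w xs c {f}))
  (solve 4 (λ w c a s → c :* w :* a :+ c :* s := c :* (w :* a :+ s)) refl
    (w x) c (f x) (weightedSum w xs f))
  where open +-*-Solver

-- Independence in summation form: it splits the first element off a random subset and the first
-- neighbourhood off a random graph.
weightedSum-product : ∀ {A B C : Set} {w : C → ℚ} {u : A → ℚ} {v : B → ℚ} (h : A → B → C) →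
  (∀ x y → w (h x y) ≡ u x ℚ.* v y) → ∀ xs ys f →
  weightedSum w (List.cartesianProductWith h xs ys) f ≡
  weightedSum u xs (λ x → weightedSum v ys (λ y → f (h x y)))
weightedSum-product h w≡ []       ys f = refl
weightedSum-product {w = w} {u} {v} h w≡ (x ∷ xs) ys f = trans
  (weightedSum-++ w (List.map (h x) ys) (List.cartesianProductWith h xs ys) f)
  (cong₂ ℚ._+_
    (trans (weightedSum-map w (h x) ys f)
      (trans (weightedSum-cong ys (w≡ x) (λ _ → refl)) (weightedSum-scale v ys (u x))))
    (weightedSum-product h w≡ xs ys f))

weightedSum-swap : ∀ {A B : Set} (u : A → ℚ) (v : B → ℚ) xs ys (f : A → B → ℚ) →
  weightedSum u xs (λ x → weightedSum v ys (f x)) ≡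
  weightedSum v ys (λ y → weightedSum u xs (λ x → f x y))
weightedSum-swap u v [] ys f = sym (zeros ys)
  where
  zeros : ∀ ys → weightedSum v ys (λ _ → 0ℚ) ≡ 0ℚ
  zeros []       = refl
  zeros (y ∷ ys) = cong₂ ℚ._+_ (ℚ.*-zeroʳ (v y)) (zeros ys)
weightedSum-swap u v (x ∷ xs) ys f = sym (trans (weightedSum-+ v ys)
  (cong₂ ℚ._+_ (weightedSum-* v ys (u x)) (sym (weightedSum-swap u v xs ys f))))

edgeWeight : ℚ → Bool → ℚ
edgeWeight r b = if b then r else 1ℚ ℚ.- r

subsetWeight : ∀ {n} → ℚ → Subset n → ℚ
subsetWeight r N = Vec.foldr _ (λ b w → edgeWeight r b ℚ.* w) 1ℚ N

graphWeight : ∀ {n} → ℚ → LabelledGraph n → ℚ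
graphWeight r ∅       = 1ℚ
graphWeight r (N ▹ G) = subsetWeight r N ℚ.* graphWeight r G

𝟙 : Bool → ℚ
𝟙 b = if b then 1ℚ else 0ℚ

total : ∀ {n} → (Fin n → ℕ) → ℕ
total {zero}  g = 0
total {suc n} g = g zero ℕ.+ total (g ∘ suc)

cherryFree : ∀ {n} → LabelledGraph n → Bool
cherryFree G = cherries G ℕ.≡ᵇ 0

module Expectation (r : ℚ) (0≤r : 0ℚ ℚ.≤ r) (r≤1 : r ℚ.≤ 1ℚ) where

  q : ℚ
  q = 1ℚ ℚ.- r

  0≤q : 0ℚ ℚ.≤ q
  0≤q = p≤q⇒0≤q-p r≤1

  𝔼ₛ : ∀ {n} → (Subset n → ℚ) → ℚ
  𝔼ₛ {n} = weightedSum (subsetWeight r) (allSubsets n)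

  𝔼 : ∀ {n} → (LabelledGraph n → ℚ) → ℚ
  𝔼 {n} = weightedSum (graphWeight r) (allGraphs n)

  edgeWeight-nonNeg : ∀ b → 0ℚ ℚ.≤ edgeWeight r b
  edgeWeight-nonNeg true  = 0≤r
  edgeWeight-nonNeg false = 0≤q

  subsetWeight-nonNeg : ∀ {n} (N : Subset n) → 0ℚ ℚ.≤ subsetWeight r N
  subsetWeight-nonNeg []      = ℚ.nonNegative⁻¹ 1ℚ
  subsetWeight-nonNeg (b ∷ N) = 0≤* (edgeWeight-nonNeg b) (subsetWeight-nonNeg N)

  graphWeight-nonNeg : ∀ {n} (G : LabelledGraph n) → 0ℚ ℚ.≤ graphWeight r G
  graphWeight-nonNeg ∅       = ℚ.nonNegative⁻¹ 1ℚ
  graphWeight-nonNeg (N ▹ G) = 0≤* (subsetWeight-nonNeg N) (graphWeight-nonNeg G)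

  𝔼-mono : ∀ {n} {f g : LabelledGraph n → ℚ} → (∀ G → f G ℚ.≤ g G) → 𝔼 f ℚ.≤ 𝔼 g
  𝔼-mono {n} = weightedSum-mono (allGraphs n) graphWeight-nonNeg

  𝔼ₛ-cong : ∀ {n} {f g : Subset n → ℚ} → (∀ N → f N ≡ g N) → 𝔼ₛ f ≡ 𝔼ₛ g
  𝔼ₛ-cong {n} = weightedSum-cong (allSubsets n) (λ _ → refl)

  𝔼-cong : ∀ {n} {f g : LabelledGraph n → ℚ} → (∀ G → f G ≡ g G) → 𝔼 f ≡ 𝔼 g
  𝔼-cong {n} = weightedSum-cong (allGraphs n) (λ _ → refl)

  𝔼ₛ-+ : ∀ {n} (f g : Subset n → ℚ) → 𝔼ₛ (λ N → f N ℚ.+ g N) ≡ 𝔼ₛ f ℚ.+ 𝔼ₛ g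
  𝔼ₛ-+ {n} f g = weightedSum-+ (subsetWeight r) (allSubsets n)

  𝔼-+ : ∀ {n} (f g : LabelledGraph n → ℚ) → 𝔼 (λ G → f G ℚ.+ g G) ≡ 𝔼 f ℚ.+ 𝔼 g
  𝔼-+ {n} f g = weightedSum-+ (graphWeight r) (allGraphs n)

  𝔼-* : ∀ {n} c (f : LabelledGraph n → ℚ) → 𝔼 (λ G → c ℚ.* f G) ≡ c ℚ.* 𝔼 f
  𝔼-* {n} c f = weightedSum-* (graphWeight r) (allGraphs n) c

  𝔼ₛ-suc : ∀ {n} (f : Subset (suc n) → ℚ) →
    𝔼ₛ f ≡ r ℚ.* 𝔼ₛ (λ N → f (inside ∷ N)) ℚ.+ q ℚ.* 𝔼ₛ (λ N → f (outside ∷ N))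
  𝔼ₛ-suc {n} f = trans
    (weightedSum-product {w = subsetWeight r} {edgeWeight r} {subsetWeight r}
      _∷_ (λ _ _ → refl) (inside ∷ outside ∷ []) (allSubsets n) f)
    (cong (r ℚ.* 𝔼ₛ (λ N → f (inside ∷ N)) ℚ.+_)
      (ℚ.+-identityʳ (q ℚ.* 𝔼ₛ (λ N → f (outside ∷ N)))))

  -- The order of summation is exchanged so that G is fixed while the neighbourhood of the new
  -- vertex is averaged.
  𝔼-suc : ∀ {n} (f : LabelledGraph (suc n) → ℚ) → 𝔼 f ≡ 𝔼 (λ G → 𝔼ₛ (λ N → f (N ▹ G)))
  𝔼-suc {n} f = trans
    (weightedSum-product {w = graphWeight r} {subsetWeight r} {graphWeight r}
      _▹_ (λ _ _ → refl) (allSubsets n) (allGraphs n) f)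
    (weightedSum-swap (subsetWeight r) (graphWeight r) (allSubsets n) (allGraphs n) (λ N G → f (N ▹ G)))

  𝔼ₛ-const : ∀ {n} c → 𝔼ₛ {n} (λ _ → c) ≡ c
  𝔼ₛ-const {zero}  c = trans (ℚ.+-identityʳ (1ℚ ℚ.* c)) (ℚ.*-identityˡ c)
  𝔼ₛ-const {suc n} c = trans (𝔼ₛ-suc {n} (λ _ → c))
    (trans (cong (λ t → r ℚ.* t ℚ.+ q ℚ.* t) (𝔼ₛ-const {n} c))
      (solve 2 (λ r c → r :* c :+ (con 1ℚ :- r) :* c := c) refl r c))
    where open +-*-Solver

  𝔼-const : ∀ {n} c → 𝔼 {n} (λ _ → c) ≡ c
  𝔼-const {zero}  c = trans (ℚ.+-identityʳ (1ℚ ℚ.* c)) (ℚ.*-identityˡ c)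
  𝔼-const {suc n} c = trans (𝔼-suc {n} (λ _ → c))
    (trans (𝔼-cong {n} (λ _ → 𝔼ₛ-const {n} c)) (𝔼-const {n} c))

  𝔼ₛ-shift : ∀ {n} c (f : Subset n → ℚ) → 𝔼ₛ (λ N → c ℚ.+ f N) ≡ c ℚ.+ 𝔼ₛ f
  𝔼ₛ-shift {n} c f = trans (𝔼ₛ-+ (λ _ → c) f) (cong (ℚ._+ 𝔼ₛ f) (𝔼ₛ-const {n} c))

  𝔼-shift : ∀ {n} c (f : LabelledGraph n → ℚ) → 𝔼 (λ G → c ℚ.+ f G) ≡ c ℚ.+ 𝔼 f
  𝔼-shift {n} c f = trans (𝔼-+ (λ _ → c) f) (cong (ℚ._+ 𝔼 f) (𝔼-const {n} c))

  -- Linearity of expectation: each element is outside N with probability q.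
  𝔼-missing : ∀ {n} (g : Fin n → ℕ) → 𝔼ₛ (λ N → ι (missing N g)) ≡ q ℚ.* ι (total g)
  𝔼-missing {zero}  g = sym (ℚ.*-zeroʳ q)
  𝔼-missing {suc n} g = begin
    𝔼ₛ (λ N → ι (missing N g))
      ≡⟨ 𝔼ₛ-suc (λ N → ι (missing N g)) ⟩
    r ℚ.* 𝔼ₛ (λ N → ι (missing N (g ∘ suc)))
      ℚ.+ q ℚ.* 𝔼ₛ (λ N → ι (g zero ℕ.+ missing N (g ∘ suc)))
      ≡⟨ cong₂ (λ s t → r ℚ.* s ℚ.+ q ℚ.* t) (𝔼-missing (g ∘ suc))
           (trans (𝔼ₛ-cong (λ N → ι-+ (g zero) (missing N (g ∘ suc))))
             (trans (𝔼ₛ-shift (ι (g zero)) (λ N → ι (missing N (g ∘ suc))))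
               (cong (ι (g zero) ℚ.+_) (𝔼-missing (g ∘ suc))))) ⟩
    r ℚ.* (q ℚ.* t) ℚ.+ q ℚ.* (ι (g zero) ℚ.+ q ℚ.* t)
      ≡⟨ solve 3 (λ r a t → let q = con 1ℚ :- r in r :* (q :* t) :+ q :* (a :+ q :* t) := q :* (a :+ t))
           refl r (ι (g zero)) t ⟩
    q ℚ.* (ι (g zero) ℚ.+ t)
      ≡⟨ cong (q ℚ.*_) (ι-+ (g zero) (total (g ∘ suc))) ⟨
    q ℚ.* ι (total g) ∎
    where
    open ≡-Reasoning
    open +-*-Solver using (solve; _:+_; _:*_; _:-_; _:=_; con)
    t = ι (total (g ∘ suc))

  total-1 : ∀ n → total {n} (λ _ → 1) ≡ n
  total-1 zero    = refl
  total-1 (suc n) = cong suc (total-1 n)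

  𝔼-missing-1 : ∀ n → 𝔼ₛ {n} (λ N → ι (missing N (λ _ → 1))) ≡ q ℚ.* ι n
  𝔼-missing-1 n = trans (𝔼-missing {n} (λ _ → 1)) (cong (λ t → q ℚ.* ι t) (total-1 n))

  -- The exact value is n(n - 1)q²/2. The cruder bound survives the recursion E + nq² because n² + n
  -- ≤ (n + 1)².
  𝔼-missingPairs : ∀ n → 𝔼ₛ {n} (λ N → ι (missingPairs N)) ℚ.≤ ι n ℚ.* ι n ℚ.* (q ℚ.* q)
  𝔼-missingPairs zero    = ℚ.≤-reflexive (sym (ℚ.*-zeroˡ (q ℚ.* q)))
  𝔼-missingPairs (suc n) = begin
    𝔼ₛ {suc n} (λ N → ι (missingPairs N))
      ≡⟨ 𝔼ₛ-suc {n} (λ N → ι (missingPairs N)) ⟩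
    r ℚ.* E ℚ.+ q ℚ.* 𝔼ₛ {n} (λ N → ι (missing N (λ _ → 1) ℕ.+ missingPairs N))
      ≡⟨ cong (λ t → r ℚ.* E ℚ.+ q ℚ.* t)
           (trans (𝔼ₛ-cong {n} (λ N → ι-+ (missing N (λ _ → 1)) (missingPairs N)))
             (trans (𝔼ₛ-+ {n} (λ N → ι (missing N (λ _ → 1))) (λ N → ι (missingPairs N)))
               (cong (ℚ._+ E) (𝔼-missing-1 n)))) ⟩
    r ℚ.* E ℚ.+ q ℚ.* (q ℚ.* ι n ℚ.+ E)
      ≡⟨ solve 3 (λ r a e → let q = con 1ℚ :- r in r :* e :+ q :* (q :* a :+ e) := e :+ a :* (q :* q))
           refl r (ι n) E ⟩
    E ℚ.+ ι n ℚ.* (q ℚ.* q)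
      ≤⟨ ℚ.+-monoˡ-≤ (ι n ℚ.* (q ℚ.* q)) (𝔼-missingPairs n) ⟩
    ι n ℚ.* ι n ℚ.* (q ℚ.* q) ℚ.+ ι n ℚ.* (q ℚ.* q)
      ≤⟨ ≤-by-difference ((ι n ℚ.+ 1ℚ) ℚ.* (q ℚ.* q))
           (0≤* (0≤+ (0≤ι n) (ℚ.nonNegative⁻¹ 1ℚ)) (0≤p² q))
           (solve 2 (λ a s → (a :* a :* s :+ a :* s) :+ (a :+ con 1ℚ) :* s
              := (a :+ con 1ℚ) :* (a :+ con 1ℚ) :* s) refl (ι n) (q ℚ.* q)) ⟩
    (ι n ℚ.+ 1ℚ) ℚ.* (ι n ℚ.+ 1ℚ) ℚ.* (q ℚ.* q)
      ≡⟨ cong (λ t → t ℚ.* t ℚ.* (q ℚ.* q)) (ι-suc n) ⟨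
    ι (suc n) ℚ.* ι (suc n) ℚ.* (q ℚ.* q) ∎
    where
    open ℚ.≤-Reasoning
    open +-*-Solver using (solve; _:+_; _:*_; _:-_; _:=_; con)
    E = 𝔼ₛ {n} (λ N → ι (missingPairs N))

  -- Handshake: a non-edge at the new vertex counts once at that vertex and once at its other end.
  total-nonNeighbours : ∀ {n} (N : Subset n) (G : LabelledGraph n) →
    total (nonNeighbours (N ▹ G)) ≡
    missing N (λ _ → 1) ℕ.+ (missing N (λ _ → 1) ℕ.+ total (nonNeighbours G))
  total-nonNeighbours N G = cong (missing N (λ _ → 1) ℕ.+_) (split N (nonNeighbours G))
    where
    +-swap : ∀ a b c → a ℕ.+ (b ℕ.+ c) ≡ b ℕ.+ (a ℕ.+ c)
    +-swap a b c = trans (sym (ℕ.+-assoc a b c))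
      (trans (cong (ℕ._+ c) (ℕ.+-comm a b)) (ℕ.+-assoc b a c))
    split : ∀ {n} (N : Subset n) (g : Fin n → ℕ) →
      total (λ v → (if Vec.lookup N v then 0 else 1) ℕ.+ g v) ≡ missing N (λ _ → 1) ℕ.+ total g
    split []            g = refl
    split (inside  ∷ N) g = trans (cong (g zero ℕ.+_) (split N (g ∘ suc)))
      (+-swap (g zero) (missing N (λ _ → 1)) (total (g ∘ suc)))
    split (outside ∷ N) g = cong suc (trans (cong (g zero ℕ.+_) (split N (g ∘ suc)))
      (+-swap (g zero) (missing N (λ _ → 1)) (total (g ∘ suc))))

  𝔼-nonNeighbours : ∀ n → 𝔼 {n} (λ G → ι (total (nonNeighbours G))) ℚ.≤ ι n ℚ.* ι n ℚ.* q
  𝔼-nonNeighbours zero    = ℚ.≤-reflexive (sym (ℚ.*-zeroˡ q))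
  𝔼-nonNeighbours (suc n) = begin
    𝔼 {suc n} (λ G → ι (total (nonNeighbours G)))
      ≡⟨ 𝔼-suc {n} (λ G → ι (total (nonNeighbours G))) ⟩
    𝔼 {n} (λ G → 𝔼ₛ {n} (λ N → ι (total (nonNeighbours (N ▹ G)))))
      ≡⟨ 𝔼-cong {n} extend ⟩
    𝔼 {n} (λ G → (q ℚ.* ι n ℚ.+ q ℚ.* ι n) ℚ.+ ι (total (nonNeighbours G)))
      ≡⟨ 𝔼-shift {n} (q ℚ.* ι n ℚ.+ q ℚ.* ι n) (λ G → ι (total (nonNeighbours G))) ⟩
    (q ℚ.* ι n ℚ.+ q ℚ.* ι n) ℚ.+ 𝔼 {n} (λ G → ι (total (nonNeighbours G)))
      ≤⟨ ℚ.+-monoʳ-≤ (q ℚ.* ι n ℚ.+ q ℚ.* ι n) (𝔼-nonNeighbours n) ⟩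
    (q ℚ.* ι n ℚ.+ q ℚ.* ι n) ℚ.+ ι n ℚ.* ι n ℚ.* q
      ≤⟨ ≤-by-difference q 0≤q (solve 2 (λ a q → (q :* a :+ q :* a) :+ a :* a :* q :+ q
           := (a :+ con 1ℚ) :* (a :+ con 1ℚ) :* q) refl (ι n) q) ⟩
    (ι n ℚ.+ 1ℚ) ℚ.* (ι n ℚ.+ 1ℚ) ℚ.* q
      ≡⟨ cong (λ t → t ℚ.* t ℚ.* q) (ι-suc n) ⟨
    ι (suc n) ℚ.* ι (suc n) ℚ.* q ∎
    where
    open ℚ.≤-Reasoning
    open +-*-Solver using (solve; _:+_; _:*_; _:-_; _:=_; con)
    extend : ∀ (G : LabelledGraph n) → 𝔼ₛ {n} (λ N → ι (total (nonNeighbours (N ▹ G)))) ≡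
             (q ℚ.* ι n ℚ.+ q ℚ.* ι n) ℚ.+ ι (total (nonNeighbours G))
    extend G = let t = total (nonNeighbours G); M = λ (N : Subset n) → missing N (λ _ → 1) in
      trans (𝔼ₛ-cong {n} λ N → trans (cong ι (total-nonNeighbours N G))
        (trans (ι-+ (M N) (M N ℕ.+ t)) (trans (cong (ι (M N) ℚ.+_) (ι-+ (M N) t))
          (solve 2 (λ m t → m :+ (m :+ t) := t :+ (m :+ m)) refl (ι (M N)) (ι t)))))
      (trans (𝔼ₛ-shift {n} (ι t) (λ N → ι (M N) ℚ.+ ι (M N)))
        (trans (cong (ι t ℚ.+_) (trans (𝔼ₛ-+ {n} (λ N → ι (M N)) (λ N → ι (M N)))
                 (cong₂ ℚ._+_ (𝔼-missing-1 n) (𝔼-missing-1 n))))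
          (ℚ.+-comm (ι t) (q ℚ.* ι n ℚ.+ q ℚ.* ι n))))

  -- Since N is independent of G, `𝔼-missing` applies with the non-degrees of G held fixed. Both
  -- kinds of new pairs contribute at most n²q² in expectation, and n³ + 2n² ≤ (n + 1)³; the exact
  -- value is n(n - 1)(n - 2)q²/2.
  𝔼-cherries : ∀ n → 𝔼 {n} (λ G → ι (cherries G)) ℚ.≤ ι n ℚ.* ι n ℚ.* ι n ℚ.* (q ℚ.* q)
  𝔼-cherries zero    = ℚ.≤-reflexive (sym (ℚ.*-zeroˡ (q ℚ.* q)))
  𝔼-cherries (suc n) = begin
    𝔼 {suc n} (λ G → ι (cherries G))
      ≡⟨ 𝔼-suc {n} (λ G → ι (cherries G)) ⟩
    𝔼 {n} (λ G → 𝔼ₛ {n} (λ N → ι (cherries (N ▹ G))))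
      ≤⟨ 𝔼-mono {n} extend ⟩
    𝔼 {n} (λ G → P ℚ.+ (ι (cherries G) ℚ.+ q ℚ.* ι (total (nonNeighbours G))))
      ≡⟨ trans (𝔼-shift {n} P (λ G → ι (cherries G) ℚ.+ q ℚ.* ι (total (nonNeighbours G))))
           (cong (P ℚ.+_) (trans (𝔼-+ {n} (λ G → ι (cherries G)) (λ G → q ℚ.* ι (total (nonNeighbours G))))
             (cong (𝔼 {n} (λ G → ι (cherries G)) ℚ.+_) (𝔼-* {n} q (λ G → ι (total (nonNeighbours G))))))) ⟩
    P ℚ.+ (𝔼 {n} (λ G → ι (cherries G)) ℚ.+ q ℚ.* 𝔼 {n} (λ G → ι (total (nonNeighbours G))))
      ≤⟨ ℚ.+-monoʳ-≤ P (ℚ.+-mono-≤ (𝔼-cherries n) (*-monoˡ q 0≤q (𝔼-nonNeighbours n))) ⟩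
    P ℚ.+ (ι n ℚ.* ι n ℚ.* ι n ℚ.* (q ℚ.* q) ℚ.+ q ℚ.* (ι n ℚ.* ι n ℚ.* q))
      ≤⟨ ≤-by-difference ((ι n ℚ.* ι n ℚ.+ (ι n ℚ.+ ι n ℚ.+ ι n ℚ.+ 1ℚ)) ℚ.* (q ℚ.* q))
           (0≤* (0≤+ (0≤p² (ι n)) (0≤+ (0≤+ (0≤+ (0≤ι n) (0≤ι n)) (0≤ι n)) (ℚ.nonNegative⁻¹ 1ℚ))) (0≤p² q))
           (solve 2 (λ a q → a :* a :* (q :* q) :+ (a :* a :* a :* (q :* q) :+ q :* (a :* a :* q))
                :+ (a :* a :+ (a :+ a :+ a :+ con 1ℚ)) :* (q :* q)
              := (a :+ con 1ℚ) :* (a :+ con 1ℚ) :* (a :+ con 1ℚ) :* (q :* q)) refl (ι n) q) ⟩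
    (ι n ℚ.+ 1ℚ) ℚ.* (ι n ℚ.+ 1ℚ) ℚ.* (ι n ℚ.+ 1ℚ) ℚ.* (q ℚ.* q)
      ≡⟨ cong (λ t → t ℚ.* t ℚ.* t ℚ.* (q ℚ.* q)) (ι-suc n) ⟨
    ι (suc n) ℚ.* ι (suc n) ℚ.* ι (suc n) ℚ.* (q ℚ.* q) ∎
    where
    open ℚ.≤-Reasoning
    open +-*-Solver using (solve; _:+_; _:*_; _:-_; _:=_; con)
    P = ι n ℚ.* ι n ℚ.* (q ℚ.* q)
    extend : ∀ (G : LabelledGraph n) → 𝔼ₛ {n} (λ N → ι (cherries (N ▹ G))) ℚ.≤
             P ℚ.+ (ι (cherries G) ℚ.+ q ℚ.* ι (total (nonNeighbours G)))
    extend G = begin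
      𝔼ₛ {n} (λ N → ι (cherries (N ▹ G)))
        ≡⟨ 𝔼ₛ-cong {n} (λ N → trans (ι-+ (cherries G) (missingPairs N ℕ.+ missing N (nonNeighbours G)))
             (cong (ι (cherries G) ℚ.+_) (ι-+ (missingPairs N) (missing N (nonNeighbours G))))) ⟩
      𝔼ₛ {n} (λ N → ι (cherries G) ℚ.+ (ι (missingPairs N) ℚ.+ ι (missing N (nonNeighbours G))))
        ≡⟨ trans (𝔼ₛ-shift {n} (ι (cherries G)) (λ N → ι (missingPairs N) ℚ.+ ι (missing N (nonNeighbours G))))
             (cong (ι (cherries G) ℚ.+_) (trans
               (𝔼ₛ-+ {n} (λ N → ι (missingPairs N)) (λ N → ι (missing N (nonNeighbours G))))
               (cong (E ℚ.+_) (𝔼-missing (nonNeighbours G))))) ⟩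
      ι (cherries G) ℚ.+ (E ℚ.+ q ℚ.* ι (total (nonNeighbours G)))
        ≤⟨ ℚ.+-monoʳ-≤ (ι (cherries G)) (ℚ.+-monoˡ-≤ (q ℚ.* ι (total (nonNeighbours G))) (𝔼-missingPairs n)) ⟩
      ι (cherries G) ℚ.+ (P ℚ.+ q ℚ.* ι (total (nonNeighbours G)))
        ≡⟨ solve 3 (λ c p t → c :+ (p :+ t) := p :+ (c :+ t)) refl
             (ι (cherries G)) P (q ℚ.* ι (total (nonNeighbours G))) ⟩
      P ℚ.+ (ι (cherries G) ℚ.+ q ℚ.* ι (total (nonNeighbours G))) ∎
      where E = 𝔼ₛ {n} (λ N → ι (missingPairs N))

  Pr : ∀ {n} → (LabelledGraph n → Bool) → ℚ
  Pr S = 𝔼 (λ G → 𝟙 (S G))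

  Pr-disjoint : ∀ {n} (S S′ : LabelledGraph n → Bool) → (∀ G → T (S G) → T (S′ G) → ⊥) →
                Pr S ℚ.+ Pr S′ ℚ.≤ 1ℚ
  Pr-disjoint {n} S S′ disjoint = begin
    Pr S ℚ.+ Pr S′                         ≡⟨ 𝔼-+ {n} (λ G → 𝟙 (S G)) (λ G → 𝟙 (S′ G)) ⟨
    𝔼 {n} (λ G → 𝟙 (S G) ℚ.+ 𝟙 (S′ G))     ≤⟨ 𝔼-mono {n} (λ G → at-most-one (S G) (S′ G) (disjoint G)) ⟩
    𝔼 {n} (λ _ → 1ℚ)                       ≡⟨ 𝔼-const {n} 1ℚ ⟩
    1ℚ                                     ∎
    where
    open ℚ.≤-Reasoning
    at-most-one : ∀ b c → (T b → T c → ⊥) → 𝟙 b ℚ.+ 𝟙 c ℚ.≤ 1ℚ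
    at-most-one true  true  d = ⊥-elim (d tt tt)
    at-most-one true  false d = ℚ.≤-refl
    at-most-one false true  d = ℚ.≤-refl
    at-most-one false false d = ℚ.nonNegative⁻¹ 1ℚ

  -- First moment method: every natural number c is 0 or at least 1, so the indicator of c = 0 plus
  -- c is at least 1; take expectations.
  Pr-cherryFree : ∀ n → 1ℚ ℚ.≤ Pr {n} cherryFree ℚ.+ ι n ℚ.* ι n ℚ.* ι n ℚ.* (q ℚ.* q)
  Pr-cherryFree n = begin
    1ℚ                                                 ≡⟨ 𝔼-const {n} 1ℚ ⟨
    𝔼 {n} (λ _ → 1ℚ)                                   ≤⟨ 𝔼-mono {n} (λ G → markov (cherries G)) ⟩
    𝔼 {n} (λ G → 𝟙 (cherryFree G) ℚ.+ ι (cherries G))  ≡⟨ 𝔼-+ {n} (λ G → 𝟙 (cherryFree G)) (λ G → ι (cherries G)) ⟩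
    Pr {n} cherryFree ℚ.+ 𝔼 {n} (λ G → ι (cherries G)) ≤⟨ ℚ.+-monoʳ-≤ (Pr {n} cherryFree) (𝔼-cherries n) ⟩
    Pr {n} cherryFree ℚ.+ ι n ℚ.* ι n ℚ.* ι n ℚ.* (q ℚ.* q) ∎
    where
    open ℚ.≤-Reasoning
    markov : ∀ c → 1ℚ ℚ.≤ 𝟙 (c ℕ.≡ᵇ 0) ℚ.+ ι c
    markov zero    = ℚ.≤-refl
    markov (suc c) = subst (1ℚ ℚ.≤_) (sym (ℚ.+-identityˡ (ι (suc c)))) (ι-mono {1} {suc c} (ℕ.s≤s ℕ.z≤n))

-- Real probabilities and their rational approximations

seq-weight : ∀ p m {n} (G : LabelledGraph n) → seq (weight p G) m ≡ graphWeight (seq p m) G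
seq-weight p m ∅       = refl
seq-weight p m (N ▹ G) = cong₂ ℚ._*_ (seq-subset N) (seq-weight p m G)
  where
  seq-subset : ∀ {n} (N : Subset n) →
    seq (Vec.foldr _ (λ b w → (if b then p else 1ℝ - p) * w) 1ℝ N) m ≡ subsetWeight (seq p m) N
  seq-subset []            = refl
  seq-subset (inside  ∷ N) = cong (seq p m ℚ.*_) (seq-subset N)
  seq-subset (outside ∷ N) = cong ((1ℚ ℚ.- seq p m) ℚ.*_) (seq-subset N)

filterᵇ-∷ : ∀ {A : Set} (S : A → Bool) x xs →
  List.filterᵇ S (x ∷ xs) ≡ (if S x then x ∷ List.filterᵇ S xs else List.filterᵇ S xs)
filterᵇ-∷ S x xs with S x
... | true  = refl
... | false = refl

-- A probability is a polynomial in p built from termwise operations, so its m-th approximation is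
-- the same polynomial at `seq p m`.
seq-ℙ : ∀ p m n (S : LabelledGraph n → Bool) →
  seq (ℙ n p S) m ≡ weightedSum (graphWeight (seq p m)) (allGraphs n) (λ G → 𝟙 (S G))
seq-ℙ p m n S = go (allGraphs n)
  where
  w = graphWeight (seq p m)

  sumWeights : List (LabelledGraph n) → ℚ
  sumWeights Gs = seq (List.foldr _+_ 0ℝ (List.map (weight p) Gs)) m

  add : ∀ b G Gs → sumWeights (if b then G ∷ Gs else Gs) ≡ w G ℚ.* 𝟙 b ℚ.+ sumWeights Gs
  add true  G Gs = cong (ℚ._+ sumWeights Gs)
    (trans (seq-weight p m G) (sym (ℚ.*-identityʳ (w G))))
  add false G Gs = trans (sym (ℚ.+-identityˡ (sumWeights Gs)))
    (cong (ℚ._+ sumWeights Gs) (sym (ℚ.*-zeroʳ (w G))))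

  go : ∀ Gs → sumWeights (List.filterᵇ S Gs) ≡ weightedSum w Gs (λ G → 𝟙 (S G))
  go []       = refl
  go (G ∷ Gs) = trans (cong sumWeights (filterᵇ-∷ S G Gs))
    (trans (add (S G) G (List.filterᵇ S Gs)) (cong (w G ℚ.* 𝟙 (S G) ℚ.+_) (go Gs)))

-- The projection of ℝ onto [0, 1], written with absolute values. It makes the
-- approximations of a probability probabilities themselves.
clamp : ℝ → ℝ
clamp x = fromℚ ½ * (∣ x ∣ - ∣ x - 1ℝ ∣ + 1ℝ)

module ClampBounds (r : ℚ) where
  open import Data.Rational using () renaming
    (_+_ to _⊕_; _*_ to _⊗_; _-_ to _⊖_; -_ to ⊖_; _≤_ to _≼_; ∣_∣ to abs)
  open ℚ.≤-Reasoning

  c : ℚ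
  c = ½ ⊗ (abs r ⊖ abs (r ⊖ 1ℚ) ⊕ 1ℚ)

  0≤c : 0ℚ ≼ c
  0≤c = 0≤* (ℚ.<⇒≤ 0<½) (subst (0ℚ ≼_)
    (solve 2 (λ a b → a :+ con 1ℚ :- b := a :- b :+ con 1ℚ) refl (abs r) (abs (r ⊖ 1ℚ)))
    (p≤q⇒0≤q-p (ℚ.∣p-q∣≤∣p∣+∣q∣ r 1ℚ)))
    where open +-*-Solver

  c≤1 : c ≼ 1ℚ
  c≤1 = *-monoˡ ½ (ℚ.<⇒≤ 0<½) (ℚ.+-monoˡ-≤ 1ℚ (begin
    abs r ⊖ b             ≡⟨ cong (λ t → abs t ⊖ b) (solve 1 (λ r → r := r :- con 1ℚ :+ con 1ℚ) refl r) ⟩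
    abs (r ⊖ 1ℚ ⊕ 1ℚ) ⊖ b ≤⟨ ℚ.+-monoˡ-≤ (⊖ b) (ℚ.∣p+q∣≤∣p∣+∣q∣ (r ⊖ 1ℚ) 1ℚ) ⟩
    b ⊕ 1ℚ ⊖ b            ≡⟨ solve 1 (λ b → b :+ con 1ℚ :- b := con 1ℚ) refl b ⟩
    1ℚ                    ∎))
    where
    open +-*-Solver using (solve; _:+_; _:*_; _:-_; _:=_; con)
    b = abs (r ⊖ 1ℚ)

  -- Clamping does not increase the distance to 1, by 1 ≤ |r| + |r - 1|. This carries the hypothesis
  -- on 1 - p over to the clamped approximations.
  1-c≤ : 1ℚ ⊖ c ≼ abs (1ℚ ⊖ r)
  1-c≤ = begin
    1ℚ ⊖ c                        ≡⟨ solve 2 (λ a b → con 1ℚ :- con ½ :* (a :- b :+ con 1ℚ)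
                                       := con ½ :* (con 1ℚ :+ b :- a)) refl a b ⟩
    ½ ⊗ (1ℚ ⊕ b ⊖ a)              ≤⟨ *-monoˡ ½ (ℚ.<⇒≤ 0<½) (ℚ.+-monoˡ-≤ (⊖ a) (ℚ.+-monoˡ-≤ b 1≤)) ⟩
    ½ ⊗ (a ⊕ b ⊕ b ⊖ a)           ≡⟨ solve 2 (λ a b → con ½ :* (a :+ b :+ b :- a) := b) refl a b ⟩
    b                             ≡⟨ ∣-∣-swap r 1ℚ ⟩
    abs (1ℚ ⊖ r)                  ∎
    where
    open +-*-Solver using (solve; _:+_; _:*_; _:-_; _:=_; con)
    a = abs r
    b = abs (r ⊖ 1ℚ)
    1≤ : 1ℚ ≼ a ⊕ b
    1≤ = subst (_≼ a ⊕ b) (cong abs (solve 1 (λ r → r :- (r :- con 1ℚ) := con 1ℚ) refl r))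
           (ℚ.∣p-q∣≤∣p∣+∣q∣ r (r ⊖ 1ℚ))

clamp≈ : ∀ {x} → 0ℝ ≤ x → x ≤ 1ℝ → clamp x ≈ x
clamp≈ {x} 0≤x x≤1 = ≈-trans {clamp x} {fromℚ ½ * (x - (1ℝ - x) + 1ℝ)} {x}
  (*-cong {fromℚ ½} {fromℚ ½} {∣ x ∣ - ∣ x - 1ℝ ∣ + 1ℝ} {x - (1ℝ - x) + 1ℝ} (≈-refl {fromℚ ½})
    (+-cong {∣ x ∣ - ∣ x - 1ℝ ∣} {x - (1ℝ - x)} {1ℝ} {1ℝ}
      (sub-cong {∣ x ∣} {x} {∣ x - 1ℝ ∣} {1ℝ - x} (0≤x⇒∣x∣≈x {x} 0≤x)
        (≈-trans {∣ x - 1ℝ ∣} {∣ 1ℝ - x ∣} {1ℝ - x}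
          (≐⇒≈ {∣ x - 1ℝ ∣} {∣ 1ℝ - x ∣} λ n → ∣-∣-swap (seq x n) 1ℚ)
          (0≤x⇒∣x∣≈x {1ℝ - x} 0≤1-x)))
      (≈-refl {1ℝ})))
  (≐⇒≈ {fromℚ ½ * (x - (1ℝ - x) + 1ℝ)} {x} λ n →
    solve 1 (λ x → con ½ :* (x :- (con 1ℚ :- x) :+ con 1ℚ) := x) refl (seq x n))
  where
  open +-*-Solver
  0≤1-x : 0ℝ ≤ 1ℝ - x
  0≤1-x ε 0<ε = map-ev
    (λ n h → subst (0ℚ ℚ.≤_)
      (solve 2 (λ x e → con 1ℚ :+ e :- x := con 1ℚ :- x :+ e) refl (seq x n) ε) (p≤q⇒0≤q-p h))
    (x≤1 ε 0<ε)

weight-cong : ∀ {p p′} → p ≈ p′ → ∀ {n} (G : LabelledGraph n) → weight p G ≈ weight p′ G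
weight-cong p≈ ∅ = ≈-refl {1ℝ}
weight-cong {p} {p′} p≈ (N ▹ G) =
  *-cong {subsetWeightᵣ p N} {subsetWeightᵣ p′ N} {weight p G} {weight p′ G}
    (subset-cong N) (weight-cong {p} {p′} p≈ G)
  where
  edgeWeightᵣ : ℝ → Bool → ℝ
  edgeWeightᵣ p b = if b then p else 1ℝ - p
  subsetWeightᵣ : ∀ {n} → ℝ → Subset n → ℝ
  subsetWeightᵣ p N = Vec.foldr _ (λ b w → (if b then p else 1ℝ - p) * w) 1ℝ N
  edge-cong : ∀ b → edgeWeightᵣ p b ≈ edgeWeightᵣ p′ b
  edge-cong true  = p≈
  edge-cong false = sub-cong {1ℝ} {1ℝ} {p} {p′} (≈-refl {1ℝ}) p≈
  subset-cong : ∀ {n} (N : Subset n) → subsetWeightᵣ p N ≈ subsetWeightᵣ p′ N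
  subset-cong []      = ≈-refl {1ℝ}
  subset-cong (b ∷ N) = *-cong {edgeWeightᵣ p b} {edgeWeightᵣ p′ b}
    {subsetWeightᵣ p N} {subsetWeightᵣ p′ N} (edge-cong b) (subset-cong N)

ℙ-cong : ∀ n {p p′} S → p ≈ p′ → ℙ n p S ≈ ℙ n p′ S
ℙ-cong n {p} {p′} S p≈ = go (List.filterᵇ S (allGraphs n))
  where
  sumWeights : ℝ → List (LabelledGraph n) → ℝ
  sumWeights p Gs = List.foldr _+_ 0ℝ (List.map (weight p) Gs)
  go : ∀ Gs → sumWeights p Gs ≈ sumWeights p′ Gs
  go []       = ≈-refl {0ℝ}
  go (G ∷ Gs) = +-cong {weight p G} {weight p′ G} {sumWeights p Gs} {sumWeights p′ Gs}
    (weight-cong {p} {p′} p≈ G) (go Gs)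

<-respʳ-≈ : ∀ {a x y} → x ≈ y → a < x → a < y
<-respʳ-≈ {a} {x} {y} x≈y (ε , 0<ε , a<x) = half ε , half-pos 0<ε , zip-ev
  (λ n → shift (seq a n) (seq x n) (seq y n) ε) a<x (x≈y (half ε) (half-pos 0<ε))
  where
  shift : ∀ a x y ε → a ℚ.+ ε ℚ.≤ x → ℚ.∣ x ℚ.- y ∣ ℚ.< half ε → a ℚ.+ half ε ℚ.≤ y
  shift a x y ε a+ε≤x x~y = begin
    a ℚ.+ half ε                    ≡⟨ solve 2 (λ a e → a :+ con ½ :* e := a :+ e :- con ½ :* e) refl a ε ⟩
    a ℚ.+ ε ℚ.- half ε              ≤⟨ ℚ.+-monoˡ-≤ (ℚ.- half ε) a+ε≤x ⟩
    x ℚ.- half ε                    ≤⟨ ℚ.+-monoˡ-≤ (ℚ.- half ε) (ℚ.<⇒≤ (∣-∣-one-sided {x} {y} x~y)) ⟩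
    y ℚ.+ half ε ℚ.- half ε         ≡⟨ solve 2 (λ y h → y :+ h :- h := y) refl y (half ε) ⟩
    y                               ∎
    where
    open ℚ.≤-Reasoning
    open +-*-Solver using (solve; _:+_; _:*_; _:-_; _:=_; con)

module _ {p : ℝ} (0≤p : 0ℝ ≤ p) (p≤1 : p ≤ 1ℝ) where

  private
    p′ = clamp p
    module E (m : ℕ) = Expectation (ClampBounds.c (seq p m))
      (ClampBounds.0≤c (seq p m)) (ClampBounds.c≤1 (seq p m))

    p≈p′ : p ≈ p′
    p≈p′ = ≈-sym {p′} {p} (clamp≈ {p} 0≤p p≤1)

  exceeds-Pr : ∀ {n} {S : LabelledGraph n → Bool} → fromℚ ½ < ℙ n p S →
               Eventually λ m → ½ ℚ.< E.Pr m S
  exceeds-Pr {n} {S} h =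
    let (ε , 0<ε , ev) = <-respʳ-≈ {fromℚ ½} {ℙ n p S} {ℙ n p′ S} (ℙ-cong n {p} {p′} S p≈p′) h
    in map-ev (λ m ½+ε≤ → subst (½ ℚ.<_) (seq-ℙ p′ m n S)
         (ℚ.<-≤-trans (subst (ℚ._< ½ ℚ.+ ε) (ℚ.+-identityʳ ½) (ℚ.+-monoʳ-< ½ 0<ε)) ½+ε≤)) ev

  -- At a common index both rational probabilities exceed 1/2, while those of disjoint events add up
  -- to at most 1.
  exceeding-events-meet : ∀ {n} {S S′ : LabelledGraph n → Bool} →
    fromℚ ½ < ℙ n p S → fromℚ ½ < ℙ n p S′ → (∀ G → T (S G) → T (S′ G) → ⊥) → ⊥
  exceeding-events-meet {n} {S} {S′} h h′ disjoint =
    let (m , both) = zip-ev {R = λ m → 1ℚ ℚ.< E.Pr m S ℚ.+ E.Pr m S′}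
                       (λ _ → ℚ.+-mono-<) (exceeds-Pr {n} {S} h) (exceeds-Pr {n} {S′} h′)
    in ℚ.<-irrefl refl (ℚ.<-≤-trans (both m ℕ.≤-refl) (E.Pr-disjoint m S S′ disjoint))

  -- The strict order on reals demands one positive gap for all late indices; 3/4 provides the gap
  -- 1/4 above 1/2.
  exceeds-if-¾≤Pr : ∀ {n} {S : LabelledGraph n → Bool} → Eventually (λ m → ¾ ℚ.≤ E.Pr m S) →
                    fromℚ ½ < ℙ n p S
  exceeds-if-¾≤Pr {n} {S} ev = <-respʳ-≈ {fromℚ ½} {ℙ n p′ S} {ℙ n p S}
    (≈-sym {ℙ n p S} {ℙ n p′ S} (ℙ-cong n {p} {p′} S p≈p′))
    (¼ , 0<¼ , map-ev (λ m → subst (¾ ℚ.≤_) (sym (seq-ℙ p′ m n S))) ev)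

  ¾≤Pr-cherryFree : ∀ n → (Eventually λ m → let q = 1ℚ ℚ.- ClampBounds.c (seq p m) in
      ι n ℚ.* ι n ℚ.* ι n ℚ.* (q ℚ.* q) ℚ.≤ ¼) →
    Eventually λ m → ¾ ℚ.≤ E.Pr m (cherryFree {n})
  ¾≤Pr-cherryFree n = map-ev λ m small →
    complement (ℚ.≤-trans (E.Pr-cherryFree m n) (ℚ.+-monoʳ-≤ (E.Pr m (cherryFree {n})) small))
    where
    complement : ∀ {x} → 1ℚ ℚ.≤ x ℚ.+ ¼ → ¾ ℚ.≤ x
    complement {x} h = subst (¾ ℚ.≤_) (solve 1 (λ x → x :+ con ¼ :- con ¼ := x) refl x)
      (ℚ.+-monoˡ-≤ (ℚ.- ¼) h)
      where open +-*-Solver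

-- From the growth hypothesis to n³q² ≤ 1/4

n³q²≤¼ : ∀ {K t s q} → 0ℚ ℚ.≤ K → K ℚ.* t ≡ 1ℚ → 0ℚ ℚ.≤ t → t ℚ.≤ 1ℚ → s ℚ.* s ℚ.≤ t →
         0ℚ ℚ.≤ q → q ℚ.≤ ¼ ℚ.* s ℚ.+ ¼ ℚ.* t → K ℚ.* (q ℚ.* q) ℚ.≤ ¼
n³q²≤¼ {K} {t} {s} {q} 0≤K Kt≡1 0≤t t≤1 s²≤t 0≤q q≤ = begin
  K ℚ.* (q ℚ.* q)
    ≤⟨ *-monoˡ K 0≤K (square-≤ 0≤q q≤) ⟩
  K ℚ.* ((¼ ℚ.* s ℚ.+ ¼ ℚ.* t) ℚ.* (¼ ℚ.* s ℚ.+ ¼ ℚ.* t))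
    -- Here K is n³, t is 1/n³ and s approximates √t. From (s + t)² ≤ 2(s² + t²), s² ≤ t and t² ≤ t
    -- follows (s + t)²/16 ≤ t/4.
    ≤⟨ *-monoˡ K 0≤K (≤-by-difference (¼ ℚ.* ¼ ℚ.* ((s ℚ.- t) ℚ.* (s ℚ.- t)))
         (0≤* (ℚ.nonNegative⁻¹ (¼ ℚ.* ¼)) (0≤p² (s ℚ.- t)))
         (solve 2 (λ s t → (con ¼ :* s :+ con ¼ :* t) :* (con ¼ :* s :+ con ¼ :* t)
              :+ con ¼ :* con ¼ :* ((s :- t) :* (s :- t))
            := con ½ :* con ¼ :* (s :* s :+ t :* t)) refl s t)) ⟩
  K ℚ.* (½ ℚ.* ¼ ℚ.* (s ℚ.* s ℚ.+ t ℚ.* t))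
    ≤⟨ *-monoˡ K 0≤K (*-monoˡ (½ ℚ.* ¼) (ℚ.nonNegative⁻¹ (½ ℚ.* ¼)) (ℚ.+-mono-≤ s²≤t t²≤t)) ⟩
  K ℚ.* (½ ℚ.* ¼ ℚ.* (t ℚ.+ t))
    ≡⟨ solve 2 (λ K t → K :* (con ½ :* con ¼ :* (t :+ t)) := con ¼ :* (K :* t)) refl K t ⟩
  ¼ ℚ.* (K ℚ.* t)
    ≡⟨ cong (¼ ℚ.*_) Kt≡1 ⟩
  ¼ ∎
  where
  open ℚ.≤-Reasoning
  open +-*-Solver using (solve; _:+_; _:*_; _:-_; _:=_; con)
  t²≤t : t ℚ.* t ℚ.≤ t
  t²≤t = subst (t ℚ.* t ℚ.≤_) (ℚ.*-identityʳ t) (*-monoˡ t 0≤t t≤1)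

-- The approximation is passed on as a variable with an equation, which avoids comparing unfolded
-- forms of `approx-√`.
√²≤ : ∀ r → 0ℚ ℚ.≤ r → ∀ m → seq (√ (fromℚ r)) m ℚ.* seq (√ (fromℚ r)) m ℚ.≤ r
√²≤ r 0≤r m = transport (seq (√ (fromℚ r)) m) refl
  where
  transport : ∀ s → s ≡ approx-√ r m → s ℚ.* s ℚ.≤ r
  transport _ refl = approx-√²≤ m 0≤r

-- A rational upper bound for the squares of the approximations of s, which
-- stands for 1/√M.
record SquareBound (M : ℕ) (s : ℝ) : Set where
  field
    t       : ℚ
    M*t≡1   : ι M ℚ.* t ≡ 1ℚ
    0<t     : 0ℚ ℚ.< t
    t≤1     : t ℚ.≤ 1ℚ
    square≤ : ∀ m → seq s m ℚ.* seq s m ℚ.≤ t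

ι-*-reciprocal : ∀ m .{{_ : ℕ.NonZero m}} → ι m ℚ.* (+ 1 ℚ./ m) ≡ 1ℚ
ι-*-reciprocal (suc m) = ι-step m

reciprocal≤1 : ∀ m .{{_ : ℕ.NonZero m}} → (+ 1 ℚ./ m) ℚ.≤ 1ℚ
reciprocal≤1 m@(suc m-1) = subst₂ ℚ._≤_ (ℚ.*-identityˡ (step m-1)) (ι-step m-1)
  (*-monoʳ (step m-1) (ℚ.<⇒≤ (step-pos m-1)) (ι-mono {1} {m} (ℕ.s≤s ℕ.z≤n)))

0<reciprocal : ∀ m .{{_ : ℕ.NonZero m}} → 0ℚ ℚ.< + 1 ℚ./ m
0<reciprocal (suc m) = step-pos m

squareBound : ∀ M t → ι M ℚ.* t ≡ 1ℚ → 0ℚ ℚ.< t → t ℚ.≤ 1ℚ → SquareBound M (√ (fromℚ t))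
squareBound M t M*t≡1 0<t t≤1 = record
  { t = t ; M*t≡1 = M*t≡1 ; 0<t = 0<t ; t≤1 = t≤1 ; square≤ = √²≤ t (ℚ.<⇒≤ 0<t) }

√-reciprocal : ∀ M .{{M≢0 : ℕ.NonZero M}} → SquareBound M (√ (fromℚ ((+ 1 ℚ./ M) {{M≢0}})))
√-reciprocal M {{M≢0}} = squareBound M ((+ 1 ℚ./ M) {{M≢0}})
  (ι-*-reciprocal M {{M≢0}}) (0<reciprocal M {{M≢0}}) (reciprocal≤1 M {{M≢0}})

1/n^1·5-bound : ∀ n .{{_ : ℕ.NonZero n}} → SquareBound (n ℕ.^ 3) (1/n^1·5 n)
1/n^1·5-bound n@(suc _) = subst (SquareBound (n ℕ.^ 3)) refl
  (√-reciprocal (n ℕ.^ 3) {{ℕ.m^n≢0 n 3}})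

ι-cube : ∀ n → ι (n ℕ.^ 3) ≡ ι n ℚ.* ι n ℚ.* ι n
ι-cube n = trans (ι-* n (n ℕ.^ 2)) (trans (cong (ι n ℚ.*_) (trans (ι-* n (n ℕ.^ 1))
  (cong (λ m → ι n ℚ.* ι m) (ℕ.*-identityʳ n)))) (sym (ℚ.*-assoc (ι n) (ι n) (ι n))))

cherries-rare : ∀ n {p s} → SquareBound (n ℕ.^ 3) s → ∣ 1ℝ - p ∣ ≤ fromℚ ¼ * ∣ s ∣ →
  Eventually λ m → let q = 1ℚ ℚ.- ClampBounds.c (seq p m) in
    ι n ℚ.* ι n ℚ.* ι n ℚ.* (q ℚ.* q) ℚ.≤ ¼
cherries-rare n {p} {s} b q≤ = map-ev (λ m → bound (seq p m) (seq s m) (square≤ m))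
  -- The real inequality holds at late indices only up to a positive slack. The slack t/4 = 1/(4n³)
  -- does not exceed the order of the main term, about n^(-3/2)/4.
  (q≤ (¼ ℚ.* t) (pos-* 0<¼ 0<t))
  where
  open SquareBound b
  bound : ∀ r s → s ℚ.* s ℚ.≤ t → ℚ.∣ 1ℚ ℚ.- r ∣ ℚ.≤ ¼ ℚ.* ℚ.∣ s ∣ ℚ.+ ¼ ℚ.* t →
    let q = 1ℚ ℚ.- ClampBounds.c r in ι n ℚ.* ι n ℚ.* ι n ℚ.* (q ℚ.* q) ℚ.≤ ¼
  bound r s s²≤t h = n³q²≤¼ {ι n ℚ.* ι n ℚ.* ι n} {t} {ℚ.∣ s ∣} {1ℚ ℚ.- ClampBounds.c r}
    (subst (0ℚ ℚ.≤_) (ι-cube n) (0≤ι (n ℕ.^ 3)))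
    (trans (cong (ℚ._* t) (sym (ι-cube n))) M*t≡1)
    (ℚ.<⇒≤ 0<t) t≤1
    (subst (ℚ._≤ t) (sym (∣p∣²≡p² s)) s²≤t)
    (p≤q⇒0≤q-p (ClampBounds.c≤1 r))
    (ℚ.≤-trans (ClampBounds.1-c≤ r) h)

-- The values of both parameters

cherryFree⇒coMatching : ∀ {n} (G : LabelledGraph n) → T (cherryFree G) → CoMatching G
cherryFree⇒coMatching G h = cherries≡0⇒coMatching G (ℕ.≡ᵇ⇒≡ (cherries G) 0 h)

u₂≡3 : ∀ {n p} → 5 ℕ.≤ n → 0ℝ ≤ p → p ≤ 1ℝ → fromℚ ½ < ℙ n p cherryFree →
       Is-u 2 n p 3 × Is-u′ 2 n p 3
u₂≡3 {n} {p} 5≤n 0≤p p≤1 likely =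
    inj₁ (0<3 , (cherryFree , (λ G → proj₁ ∘ subgraph G) , likely)
      , λ j (S , S⊆ , exceeds) → maximal j S S⊆ exceeds)
  , inj₁ (0<3 , (cherryFree , (λ G → proj₂ ∘ subgraph G) , likely)
      , λ j (S , S⊆ , exceeds) → maximal j S (λ G → forget G ∘ S⊆ G) exceeds)
  where
  0<3 : 0 ℕ.< 3
  0<3 = ℕ.s≤s ℕ.z≤n

  subgraph : ∀ (G : LabelledGraph n) → T (cherryFree G) →
             HasDiameterSubgraph 2 3 G × HasDiameterSubgraph′ 2 3 G
  subgraph G = coMatching⇒hasDiameterSubgraph G 5≤n ∘ cherryFree⇒coMatching G

  forget : ∀ {j} (G : LabelledGraph n) → HasDiameterSubgraph′ 2 j G → HasDiameterSubgraph 2 j G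
  forget G (W , card≡ , diam , χ≡3 , _) = W , card≡ , diam , χ≡3

  maximal : ∀ j (S : LabelledGraph n → Bool) → (∀ G → T (S G) → HasDiameterSubgraph 2 j G) →
            fromℚ ½ < ℙ n p S → j ℕ.≤ 3
  maximal j S S⊆ exceeds = ℕ.≮⇒≥ λ 3<j →
    exceeding-events-meet {p} 0≤p p≤1 {n} {cherryFree} {S} likely exceeds
      λ G free inS → ℕ.<⇒≱ 3<j (coMatching⇒≤3 G (cherryFree⇒coMatching G free) (S⊆ G inS))

theorem14 : (p : ℕ → ℝ) →
    (∀ n → 0ℝ ≤ p n × p n ≤ 1ℝ) →
    (λ n → 1ℝ - p n) =o 1/n^1·5 →
    ∃ λ N → ∀ n → N ℕ.≤ n → Is-u 2 n (p n) 3 × Is-u′ 2 n (p n) 3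
theorem14 p p∈[0,1] q=o =
  -- The constant 1/4 is small enough for n³q² ≤ 1/4 even with the slack, hence for probability 3/4;
  -- the 5 below is the order that forces a triangle.
  let (N , q≤) = q=o (fromℚ ¼) (¼ , 0<¼ , always λ _ → ℚ.≤-refl)
  in N ℕ.⊔ 5 , λ n N⊔5≤n → result n (ℕ.m⊔n≤o⇒n≤o N 5 N⊔5≤n) (q≤ n (ℕ.m⊔n≤o⇒m≤o N 5 N⊔5≤n))
  where
  result : ∀ n → 5 ℕ.≤ n → ∣ 1ℝ - p n ∣ ≤ fromℚ ¼ * ∣ 1/n^1·5 n ∣ →
           Is-u 2 n (p n) 3 × Is-u′ 2 n (p n) 3
  -- Matching on a successor avoids the default value of `1/n^1·5` at 0.
  result n@(suc _) 5≤n q≤ =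
    let (0≤p , p≤1) = p∈[0,1] n
    in u₂≡3 {n} {p n} 5≤n 0≤p p≤1
         (exceeds-if-¾≤Pr {p n} 0≤p p≤1 {n} {cherryFree}
           (¾≤Pr-cherryFree {p n} 0≤p p≤1 n (cherries-rare n {p n} {1/n^1·5 n} (1/n^1·5-bound n) q≤)))
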